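{- Let $p,q$ be positive integers and let $\mathrm{SPK}_{p,q}$ be the complete split graph, with $m=pq+\binom{p}{2}$ edges. If $q\ge 4p+1$ then $$\delta(\mathcal{A}(\mathrm{SPK}_{p,q}))=2pq+\binom{p}{2}=2m-\binom{p}{2},$$ and otherwise $$\delta(\mathcal{A}(\mathrm{SPK}_{p,q}))=pq+\left\lfloor\tfrac12\binom{q}{2}\right\rfloor+\binom{p}{2}\le 2m.$$
   Context: The complete split graph $\mathrm{SPK}_{p,q}$ has vertex set $P\cup Q$ with $|P|=p$, $|Q|=q$, $P\cap Q=\emptyset$, where $P$ induces a clique, $Q$ induces an independent set, and every vertex of $P$ is adjacent to every vertex of $Q$. For a connected graph $G=(V,E)$, a search tree on $G$ is a rooted tree with vertex set $V$ defined recursively: its root is some vertex $r\in V$, and $r$ is joined to the roots of search trees on each connected component of $G-r$. The tubes of a search tree are the vertex sets of its subtrees. Two search trees on $G$ are related by a rotation if their sets of tubes have symmetric difference of size exactly two. The graph associahedron $\mathcal{A}(G)$ is a polytope whose skeleton is isomorphic to the graph on search trees of $G$ with adjacency given by rotations; $\delta(\mathcal{A}(G))$ is the diameter of this graph. -}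

module Defs where

open import Data.Nat using (ℕ; zero; suc; _+_; _*_; _≤_; _<_; _/_)
open import Data.Nat.Combinatorics using (_C_)
open import Data.Fin using (Fin; toℕ)
open import Data.Fin.Subset using (Subset; _∈_; _∉_; _⊆_; _∪_; _-_; ⁅_⁆; ⋃; ⊤)
open import Data.List using (List; []; _∷_; map)
import Data.List.Membership.Propositional as L
open import Data.List.Relation.Unary.All using (All)
open import Data.List.Relation.Unary.Any using (Any)
open import Data.List.Relation.Unary.AllPairs using (AllPairs)
open import Data.Product using (Σ; ∃; _×_; _,_)
open import Data.Sum using (_⊎_)
open import Data.Empty using (⊥)
open import Relation.Nullary using (¬_)
open import Relation.Binary.PropositionalEquality using (_≡_; _≢_)

record Graph (n : ℕ) : Set₁ where
  field
    Adj : Fin n → Fin n → Set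
open Graph public

-- The complete split graph SPK_{p,q} on Fin (p + q):
-- P = vertices with index < p (a clique), Q = the remaining q vertices
-- (an independent set), every vertex of P adjacent to every vertex of Q.
InP : {n : ℕ} → ℕ → Fin n → Set
InP p v = toℕ v < p

SPK : (p q : ℕ) → Graph (p + q)
Adj (SPK p q) u v = u ≢ v × (InP p u ⊎ InP p v)

data Reach {n : ℕ} (G : Graph n) (S : Subset n) : Fin n → Fin n → Set where
  here : ∀ {u} → u ∈ S → Reach G S u u
  step : ∀ {u w v} → u ∈ S → Adj G u w → Reach G S w v → Reach G S u v

Connected : {n : ℕ} → Graph n → Subset n → Set
Connected G S = (∃ λ v → v ∈ S) × (∀ u v → u ∈ S → v ∈ S → Reach G S u v)

IsComponent : {n : ℕ} → Graph n → Subset n → Subset n → Set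
IsComponent G S C =
  C ⊆ S × Connected G C × (∀ u v → u ∈ C → v ∈ S → Adj G u v → v ∈ C)

Disjoint : {n : ℕ} → Subset n → Subset n → Set
Disjoint A B = ∀ v → v ∈ A → v ∈ B → ⊥

data Tree (n : ℕ) : Set where
  node : Fin n → List (Tree n) → Tree n

mutual
  verts : {n : ℕ} → Tree n → Subset n
  verts (node r ts) = ⁅ r ⁆ ∪ ⋃ (vertsList ts)

  vertsList : {n : ℕ} → List (Tree n) → List (Subset n)
  vertsList [] = []
  vertsList (t ∷ ts) = verts t ∷ vertsList ts

mutual
  tubes : {n : ℕ} → Tree n → List (Subset n)
  tubes (node r ts) = verts (node r ts) ∷ tubesList ts

  tubesList : {n : ℕ} → List (Tree n) → List (Subset n)
  tubesList [] = []
  tubesList (t ∷ ts) = appendL (tubes t) (tubesList ts)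

  appendL : {n : ℕ} → List (Subset n) → List (Subset n) → List (Subset n)
  appendL [] ys = ys
  appendL (x ∷ xs) ys = x ∷ appendL xs ys

-- IsSearchTree G S T : T is a search tree on the (connected) graph G[S]:
-- its root r lies in S, and r is joined to the roots of search trees on
-- each connected component of G[S] - r (exactly one child per component).
data IsSearchTree {n : ℕ} (G : Graph n) : Subset n → Tree n → Set where
  st : ∀ {S r ts} →
       r ∈ S →
       All (λ c → IsComponent G (S - r) (verts c) × IsSearchTree G (verts c) c) ts →
       AllPairs (λ c d → Disjoint (verts c) (verts d)) ts →
       (∀ v → v ∈ S → v ≢ r → Any (λ c → v ∈ verts c) ts) →
       IsSearchTree G S (node r ts)

SearchTree : {n : ℕ} → Graph n → Tree n → Set
SearchTree G T = IsSearchTree G ⊤ T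

InSymDiff : {n : ℕ} → Tree n → Tree n → Subset n → Set
InSymDiff T U X = (X L.∈ tubes T × ¬ (X L.∈ tubes U))
                ⊎ (X L.∈ tubes U × ¬ (X L.∈ tubes T))

Rotation : {n : ℕ} → Tree n → Tree n → Set
Rotation T U = Σ _ λ A → Σ _ λ B →
  A ≢ B × InSymDiff T U A × InSymDiff T U B ×
  (∀ X → InSymDiff T U X → X ≡ A ⊎ X ≡ B)

-- T and U have the same set of tubes (i.e. they are the same vertex of
-- the rotation graph; a search tree is determined by its tubes, the
-- list representation of children merely fixes an order).
SameTubes : {n : ℕ} → Tree n → Tree n → Set
SameTubes T U = ∀ X → (X L.∈ tubes T → X L.∈ tubes U) × (X L.∈ tubes U → X L.∈ tubes T)

data Walk {n : ℕ} (G : Graph n) : ℕ → Tree n → Tree n → Set where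
  done : ∀ {T U} → SameTubes T U → Walk G zero T U
  step : ∀ {k T V U} → SearchTree G V → Rotation T V → Walk G k V U →
         Walk G (suc k) T U

-- the diameter of the rotation graph (skeleton of A(G)) equals d
Diameter : {n : ℕ} → Graph n → ℕ → Set
Diameter G d =
  (∀ T U → SearchTree G T → SearchTree G U → ∃ λ k → k ≤ d × Walk G k T U)
  × (∃ λ T → ∃ λ U → SearchTree G T × SearchTree G U ×
       (∀ k → Walk G k T U → d ≤ k))

edgesSPK : ℕ → ℕ → ℕ
edgesSPK p q = p * q + p C 2

module Submission where

-- As long as an element of P is left, removing a vertex keeps the graph connected;
-- afterwards only isolated vertices remain.  A search tree is therefore a word
-- listing all vertices, in which the letters after the last element of P (the
-- leaves) are unordered, and a rotation is a swap of two adjacent letters.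
--
-- Upper bound: one may sort one word into the other, or first sink all of Q to
-- the end, where it can be reordered for free.  For a pair in P × Q the two costs
-- sum to at most 2, so together they are at most 2pq + C(q,2) + 2 C(p,2); the
-- second cost alone is at most 2pq + C(p,2).
--
-- Lower bound: along a path let S ⊆ Q contain the vertices that are a leaf at some
-- time.  Given S, each pair of vertices needs a certain number of swaps.  The total
-- is large for every S if all pairs inside P and inside Q have to be inverted, and Q
-- starts above P and ends with (nearly) the same number of elements of P below each
-- of its vertices.

open import Defs
open import Data.Bool.Base using (Bool; true; false; if_then_else_; _∨_)
open import Data.Bool.Properties using (∨-zeroʳ) renaming (_≟_ to _≟ᵇ_)
open import Data.Fin.Base as Fin using (Fin; zero; suc; toℕ; _↑ˡ_; _↑ʳ_)
open import Data.Fin.Properties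
  using (_≟_; toℕ<n; toℕ-↑ˡ; toℕ-↑ʳ; ↑ˡ-injective; ↑ʳ-injective; splitAt⁻¹-↑ˡ; splitAt⁻¹-↑ʳ)
  renaming (any? to anyFin?)
open import Data.Fin.Subset
  using (Subset; inside; outside; _─_; _-_; ⋃; ⁅_⁆)
  renaming (_∈_ to _∈ˢ_; _∉_ to _∉ˢ_)
open import Data.Fin.Subset.Properties
  using (x∈⁅x⁆; x∈⁅y⁆⇒x≡y; x∈p∪q⁺; x∈p∪q⁻; ∉⊥; ∈⊤; ∪-identityʳ; ⊆-antisym; x∈p∧x≢y⇒x∈p-y; p─q⊆p)
  renaming (_∈?_ to _∈ˢ?_)
open import Data.List.Base using (List; []; _∷_; [_]; _++_; map; length; filter; tabulate)
import Data.List.Membership.DecPropositional as DecMembership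
open import Data.List.Membership.Propositional using (_∈_; _∉_; find; lose)
open import Data.List.Membership.Propositional.Properties using (∈-∃++; ∈-++⁺ˡ; ∈-++⁺ʳ; ∈-tabulate⁺)
open import Data.List.Properties
  using (map-++; length-++; length-tabulate; tabulate-cong; map-tabulate; filter-++; filter-all;
    filter-none; filter-accept; filter-reject; ++-identityʳ)
open import Data.List.Relation.Binary.Permutation.Propositional
open import Data.List.Relation.Binary.Permutation.Propositional.Properties
  hiding (sum-↭; ++-identityʳ)
import Data.List.Relation.Binary.Permutation.Setoid.Properties as SetoidPerm
open import Data.List.Relation.Unary.All as All using (All; []; _∷_)
open import Data.List.Relation.Unary.All.Properties as AllP using (all-filter; ¬Any⇒All¬; All¬⇒¬Any)
open import Data.List.Relation.Unary.AllPairs as AllPairs using (AllPairs; []; _∷_)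
import Data.List.Relation.Unary.AllPairs.Properties as AllPairsP
open import Data.List.Relation.Unary.Any as Any using (Any; here; there)
import Data.List.Relation.Unary.Any.Properties as AnyP
import Data.List.Relation.Unary.Sorted.TotalOrder.Properties as SortedP
open import Data.List.Relation.Unary.Unique.Propositional using (Unique)
import Data.List.Relation.Unary.Unique.Propositional.Properties as UniqueP
import Data.List.Sort as Sort
open import Data.Nat hiding (_≟_)
open import Data.Nat.Combinatorics using (_C_; nCk+nC[k+1]≡[n+1]C[k+1]; nC1≡n)
open import Data.Nat.DivMod using (m≡m%n+[m/n]*n; m%n<n; m/n*n≤m)
open import Data.Nat.ListAction using (sum)
open import Data.Nat.ListAction.Properties using (sum-++; sum-↭)
open import Data.Nat.Properties hiding (_≟_)
open import Data.Nat.Solver using (module +-*-Solver)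
open import Data.Product using (∃; _×_; _,_; proj₁; proj₂)
open import Data.Sum using (_⊎_; inj₁; inj₂; [_,_]′)
open import Data.Vec.Base using ([]; _∷_) renaming (there to thereᵛ)
open import Data.Vec.Properties using () renaming (≡-dec to ≡-decᵛ)
open import Function.Base using (case_of_)
open import Function.Bundles using (_⇔_; mk⇔; Equivalence)
open import Level using (0ℓ)
open import Relation.Binary.Bundles using (DecTotalOrder)
import Relation.Binary.Construct.Flip.EqAndOrd as Flip
import Relation.Binary.Construct.On as On
open import Relation.Binary.Definitions using (DecidableEquality)
open import Relation.Binary.PropositionalEquality as ≡ using (_≡_; _≢_; cong; cong₂; subst)
open import Relation.Nullary using (¬_; Dec; does; yes; no; contradiction)
open import Relation.Nullary.Decidable using (¬?; dec-true; dec-false; _×-dec_)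
open import Relation.Unary using (Decidable)
open Equivalence using (to; from)

-- Both values come from balancing two extreme sets S. Call the number of vertices of P below a
-- vertex of Q in the final word its depth, and let D be the sum of the depths. If S = Q, the mixed
-- pairs cost pq + D and the pairs inside Q nothing; if S is empty, they cost pq - D and C(q,2). So
-- D should be half of C(q,2), rounded down. Since no depth exceeds p, this is possible if q ≤ 4p +
-- 1; beyond that D = pq is the best choice. For a general S, leaving out a set T saves twice the
-- depth of T and costs the pairs of Q that meet T. No T may profit, which is why the depths are
-- spread evenly, over two consecutive values. The set S depends on the whole path, so the path is
-- read from its end: S grows as steps are prepended, and the cost has to survive this growth.
-- Rotations are given by tubes alone. That a rotation is a swap, up to the order of the leaves,
-- must therefore be recovered from a symmetric difference of size two.

C2-suc : ∀ n → suc n C 2 ≡ n + n C 2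
C2-suc n = ≡.trans (≡.sym (nCk+nC[k+1]≡[n+1]C[k+1] n 1)) (cong (_+ n C 2) (nC1≡n n))

-- Sums over the elements and over the pairs of a list

module _ {A : Set} where

  sumBy : (A → ℕ) → List A → ℕ
  sumBy f xs = sum (map f xs)

  -- The earlier element of each pair is the first argument, so an asymmetric `f` measures how the
  -- list is ordered. All costs of words are sums of this kind.
  pairSum : (A → A → ℕ) → List A → ℕ
  pairSum f []       = 0
  pairSum f (x ∷ xs) = sumBy (f x) xs + pairSum f xs

  sumBy-++ : ∀ f xs ys → sumBy f (xs ++ ys) ≡ sumBy f xs + sumBy f ys
  sumBy-++ f xs ys = ≡.trans (cong sum (map-++ f xs ys)) (sum-++ (map f xs) (map f ys))

  sumBy-↭ : ∀ f {xs ys} → xs ↭ ys → sumBy f xs ≡ sumBy f ys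
  sumBy-↭ f p = sum-↭ (map⁺ f p)

  sumBy-mono : ∀ {f g : A → ℕ} {xs} → All (λ x → f x ≤ g x) xs → sumBy f xs ≤ sumBy g xs
  sumBy-mono []       = z≤n
  sumBy-mono (p ∷ ps) = +-mono-≤ p (sumBy-mono ps)

  sumBy-cong : ∀ {f g : A → ℕ} {xs} → All (λ x → f x ≡ g x) xs → sumBy f xs ≡ sumBy g xs
  sumBy-cong []       = ≡.refl
  sumBy-cong (p ∷ ps) = cong₂ _+_ p (sumBy-cong ps)

  sumBy-+ : ∀ f g xs → sumBy (λ x → f x + g x) xs ≡ sumBy f xs + sumBy g xs
  sumBy-+ f g []       = ≡.refl
  sumBy-+ f g (x ∷ xs) = ≡.trans (cong (f x + g x +_) (sumBy-+ f g xs))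
    (solve 4 (λ a b c d → a :+ b :+ (c :+ d) := a :+ c :+ (b :+ d)) ≡.refl
      (f x) (g x) (sumBy f xs) (sumBy g xs))
    where open +-*-Solver

  sumBy-const : ∀ c xs → sumBy (λ _ → c) xs ≡ length xs * c
  sumBy-const c []       = ≡.refl
  sumBy-const c (x ∷ xs) = cong (c +_) (sumBy-const c xs)

  sumBy≡const : ∀ {f c xs} → All (λ x → f x ≡ c) xs → sumBy f xs ≡ length xs * c
  sumBy≡const {xs = xs} all = ≡.trans (sumBy-cong all) (sumBy-const _ xs)

  sumBy-* : ∀ c f xs → sumBy (λ x → c * f x) xs ≡ c * sumBy f xs
  sumBy-* c f []       = ≡.sym (*-zeroʳ c)
  sumBy-* c f (x ∷ xs) =
    ≡.trans (cong (c * f x +_) (sumBy-* c f xs)) (≡.sym (*-distribˡ-+ c (f x) (sumBy f xs)))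

  pairSum-++ : ∀ f xs ys →
    pairSum f (xs ++ ys) ≡ pairSum f xs + sumBy (λ x → sumBy (f x) ys) xs + pairSum f ys
  pairSum-++ f []       ys = ≡.refl
  pairSum-++ f (x ∷ xs) ys = ≡.trans (cong₂ _+_ (sumBy-++ (f x) xs ys) (pairSum-++ f xs ys))
    (solve 5 (λ a b c d e → a :+ b :+ (c :+ d :+ e) := a :+ c :+ (b :+ d) :+ e) ≡.refl
      (sumBy (f x) xs) (sumBy (f x) ys) (pairSum f xs) (sumBy (λ x → sumBy (f x) ys) xs)
      (pairSum f ys))
    where open +-*-Solver

  -- The order is respected: `v` comes second in its pairs with `xs` and first in its pairs with
  -- `ys`. This isolates the contribution of a letter taken out of the middle of a word.
  pairSum-insert : ∀ f xs v ys →
    pairSum f (xs ++ v ∷ ys) ≡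
    pairSum f (xs ++ ys) + (sumBy (λ u → f u v) xs + sumBy (f v) ys)
  pairSum-insert f []       v ys = +-comm (sumBy (f v) ys) (pairSum f ys)
  pairSum-insert f (x ∷ xs) v ys
    rewrite sumBy-↭ (f x) (shift v xs ys) | pairSum-insert f xs v ys =
    solve 5 (λ a b c d e → a :+ b :+ (c :+ (d :+ e)) := b :+ c :+ (a :+ d :+ e)) ≡.refl
      (f x v) (sumBy (f x) (xs ++ ys)) (pairSum f (xs ++ ys))
      (sumBy (λ u → f u v) xs) (sumBy (f v) ys)
    where open +-*-Solver

  pairSum-↭ : ∀ f → (∀ x y → f x y ≡ f y x) → ∀ {xs ys} → xs ↭ ys → pairSum f xs ≡ pairSum f ys
  pairSum-↭ f f-sym refl        = ≡.refl
  pairSum-↭ f f-sym (prep x p)  = cong₂ _+_ (sumBy-↭ (f x) p) (pairSum-↭ f f-sym p)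
  pairSum-↭ f f-sym (swap {xs} {ys} x y p)
    rewrite f-sym x y | sumBy-↭ (f x) p | sumBy-↭ (f y) p | pairSum-↭ f f-sym p =
    solve 4 (λ a b c d → a :+ b :+ (c :+ d) := a :+ c :+ (b :+ d)) ≡.refl
      (f y x) (sumBy (f x) ys) (sumBy (f y) ys) (pairSum f ys)
    where open +-*-Solver
  pairSum-↭ f f-sym (trans p q) = ≡.trans (pairSum-↭ f f-sym p) (pairSum-↭ f f-sym q)

  pairSum-mono : ∀ {f g : A → A → ℕ} {xs} → AllPairs (λ x y → f x y ≤ g x y) xs →
    pairSum f xs ≤ pairSum g xs
  pairSum-mono []       = z≤n
  pairSum-mono (p ∷ ps) = +-mono-≤ (sumBy-mono p) (pairSum-mono ps)

  pairSum-cong : ∀ {f g : A → A → ℕ} {xs} → AllPairs (λ x y → f x y ≡ g x y) xs →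
    pairSum f xs ≡ pairSum g xs
  pairSum-cong []       = ≡.refl
  pairSum-cong (p ∷ ps) = cong₂ _+_ (sumBy-cong p) (pairSum-cong ps)

  pairSum-+ : ∀ f g xs → pairSum (λ x y → f x y + g x y) xs ≡ pairSum f xs + pairSum g xs
  pairSum-+ f g []       = ≡.refl
  pairSum-+ f g (x ∷ xs) = ≡.trans (cong₂ _+_ (sumBy-+ (f x) (g x) xs) (pairSum-+ f g xs))
    (solve 4 (λ a b c d → a :+ b :+ (c :+ d) := a :+ c :+ (b :+ d)) ≡.refl
      (sumBy (f x) xs) (sumBy (g x) xs) (pairSum f xs) (pairSum g xs))
    where open +-*-Solver

  pairSum-const : ∀ c xs → pairSum (λ _ _ → c) xs ≡ (length xs C 2) * c
  pairSum-const c []       = ≡.refl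
  pairSum-const c (x ∷ xs) rewrite C2-suc (length xs) | sumBy-const c xs | pairSum-const c xs =
    ≡.sym (*-distribʳ-+ c (length xs) (length xs C 2))

  pairSum≡const : ∀ {f c xs} → AllPairs (λ x y → f x y ≡ c) xs →
    pairSum f xs ≡ (length xs C 2) * c
  pairSum≡const {xs = xs} all = ≡.trans (pairSum-cong all) (pairSum-const _ xs)

  pairSum-indicator : ∀ (χ : A → Bool) xs →
    pairSum (λ x y → if χ x then (if χ y then 1 else 0) else 0) xs ≡
    sumBy (λ x → if χ x then 1 else 0) xs C 2
  pairSum-indicator χ []       = ≡.refl
  pairSum-indicator χ (x ∷ xs) rewrite pairSum-indicator χ xs with χ x
  ... | true  = ≡.sym (C2-suc (sumBy (λ y → if χ y then 1 else 0) xs))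
  ... | false rewrite sumBy-const 0 xs | *-zeroʳ (length xs) = ≡.refl

  Unique-resp-↭ : ∀ {xs ys : List A} → xs ↭ ys → Unique xs → Unique ys
  Unique-resp-↭ p = SetoidPerm.Unique-resp-↭ (≡.setoid A) (↭⇒↭ₛ p)

  sameElements⇒↭ : ∀ {xs ys : List A} → Unique xs → Unique ys →
    (∀ {x} → x ∈ xs → x ∈ ys) → (∀ {x} → x ∈ ys → x ∈ xs) → xs ↭ ys
  sameElements⇒↭ {[]} {[]}     ux uy f g = refl
  sameElements⇒↭ {[]} {y ∷ ys} ux uy f g with () ← g (here ≡.refl)
  sameElements⇒↭ {x ∷ xs} (x∉ ∷ ux) uy f g with ∈-∃++ (f (here ≡.refl))
  ... | a , b , ≡.refl with Unique-resp-↭ (shift x a b) uy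
  ... | x∉′ ∷ uab = ↭-sym (trans (shift x a b) (prep x (↭-sym
    (sameElements⇒↭ ux uab
      (λ z∈ → tail∈ (λ { ≡.refl → All.lookup x∉ z∈ ≡.refl }) (∈-resp-↭ (shift x a b) (f (there z∈))))
      (λ z∈ → tail∈ (λ { ≡.refl → All.lookup x∉′ z∈ ≡.refl })
        (g (∈-resp-↭ (↭-sym (shift x a b)) (there z∈))))))))
    where
    tail∈ : ∀ {x y} {zs : List A} → x ≢ y → x ∈ y ∷ zs → x ∈ zs
    tail∈ x≢y (here eq) = contradiction eq x≢y
    tail∈ x≢y (there q) = q

-- Words, swaps and the two strategies of the upper bound

module Words {A : Set} {P : A → Set} (P? : Decidable P) where

  infix 4 _≈_ _⇄_
  infixr 5 _∷_

  -- Everything after the last element of P may be permuted freely.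
  data _≈_ : List A → List A → Set where
    tail : ∀ {s t} → All (λ v → ¬ P v) s → s ↭ t → s ≈ t
    _∷_  : ∀ v {s t} → s ≈ t → v ∷ s ≈ v ∷ t

  data _⇄_ : List A → List A → Set where
    here  : ∀ {x y s} → x ∷ y ∷ s ⇄ y ∷ x ∷ s
    there : ∀ v {s t} → s ⇄ t → v ∷ s ⇄ v ∷ t

  data Swaps : ℕ → List A → List A → Set where
    []  : ∀ {s} → Swaps 0 s s
    _∷_ : ∀ {k s t u} → s ⇄ t → Swaps k t u → Swaps (suc k) s u

  -- Words related by `_≈_` stand for the same vertex of the rotation graph, so `free` costs
  -- nothing. Swaps of two leaves are counted nevertheless.
  data Path : ℕ → List A → List A → Set where
    []   : ∀ {s} → Path 0 s s
    free : ∀ {k s t u} → s ≈ t → Path k t u → Path k s u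
    swap : ∀ {k s t u} → s ⇄ t → Path k t u → Path (suc k) s u

  ≈⇒↭ : ∀ {s t} → s ≈ t → s ↭ t
  ≈⇒↭ (tail _ p) = p
  ≈⇒↭ (v ∷ p)    = prep v (≈⇒↭ p)

  ⇄⇒↭ : ∀ {s t} → s ⇄ t → s ↭ t
  ⇄⇒↭ here        = swap _ _ refl
  ⇄⇒↭ (there v p) = prep v (⇄⇒↭ p)

  ≈-refl : ∀ {s} → s ≈ s
  ≈-refl {[]}    = tail [] refl
  ≈-refl {v ∷ s} = v ∷ ≈-refl

  ≈-sym : ∀ {s t} → s ≈ t → t ≈ s
  ≈-sym (tail np p) = tail (All-resp-↭ p np) (↭-sym p)
  ≈-sym (v ∷ p)     = v ∷ ≈-sym p

  ⇄-sym : ∀ {s t} → s ⇄ t → t ⇄ s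
  ⇄-sym here        = here
  ⇄-sym (there v p) = there v (⇄-sym p)

  ≈-++ˡ : ∀ r {s t} → s ≈ t → r ++ s ≈ r ++ t
  ≈-++ˡ []      p = p
  ≈-++ˡ (v ∷ r) p = v ∷ ≈-++ˡ r p

  ⇄-++ʳ : ∀ r {s t} → s ⇄ t → s ++ r ⇄ t ++ r
  ⇄-++ʳ r here        = here
  ⇄-++ʳ r (there v p) = there v (⇄-++ʳ r p)

  Swaps-++ʳ : ∀ r {k s t} → Swaps k s t → Swaps k (s ++ r) (t ++ r)
  Swaps-++ʳ r []       = []
  Swaps-++ʳ r (p ∷ ps) = ⇄-++ʳ r p ∷ Swaps-++ʳ r ps

  Swaps-∷ : ∀ v {k s t} → Swaps k s t → Swaps k (v ∷ s) (v ∷ t)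
  Swaps-∷ v []       = []
  Swaps-∷ v (p ∷ ps) = there v p ∷ Swaps-∷ v ps

  Swaps-trans : ∀ {k l s t u} → Swaps k s t → Swaps l t u → Swaps (k + l) s u
  Swaps-trans []       qs = qs
  Swaps-trans (p ∷ ps) qs = p ∷ Swaps-trans ps qs

  Swaps-sym : ∀ {k s t} → Swaps k s t → Swaps k t s
  Swaps-sym []               = []
  Swaps-sym {suc k} {s} {t} (p ∷ ps) =
    subst (λ j → Swaps j t s) (+-comm k 1) (Swaps-trans (Swaps-sym ps) (⇄-sym p ∷ []))

  infixr 5 _++ᵖ_
  _++ᵖ_ : ∀ {k l s t u} → Swaps k s t → Path l t u → Path (k + l) s u
  []       ++ᵖ qs = qs
  (p ∷ ps) ++ᵖ qs = swap p (ps ++ᵖ qs)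

  moveDown : ∀ v a b → Swaps (length a) (v ∷ a ++ b) (a ++ v ∷ b)
  moveDown v []      b = []
  moveDown v (u ∷ a) b = here ∷ Swaps-∷ u (moveDown v a b)

  -- Summed over a word, the cost of moving all elements outside P to the end.
  sink : A → A → ℕ
  sink v u = if does (P? v) then 0 else if does (P? u) then 1 else 0

  mixed : A → A → ℕ
  mixed v u =
    if does (P? v) then (if does (P? u) then 0 else 1) else (if does (P? u) then 1 else 0)

  mixed-sym : ∀ v u → mixed v u ≡ mixed u v
  mixed-sym v u with P? v | P? u
  ... | yes _ | yes _ = ≡.refl
  ... | yes _ | no  _ = ≡.refl
  ... | no  _ | yes _ = ≡.refl
  ... | no  _ | no  _ = ≡.refl

  sink≤mixed : ∀ v u → sink v u ≤ mixed v u
  sink≤mixed v u with P? v | P? u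
  ... | yes _ | yes _ = z≤n
  ... | yes _ | no  _ = z≤n
  ... | no  _ | yes _ = ≤-refl
  ... | no  _ | no  _ = z≤n

  mixed-PP : ∀ {v u} → P v → P u → mixed v u ≡ 0
  mixed-PP {v} {u} pv pu rewrite dec-true (P? v) pv | dec-true (P? u) pu = ≡.refl

  mixed-QQ : ∀ {v u} → ¬ P v → ¬ P u → mixed v u ≡ 0
  mixed-QQ {v} {u} qv qu rewrite dec-false (P? v) qv | dec-false (P? u) qu = ≡.refl

  mixed-QP : ∀ {v u} → ¬ P v → P u → mixed v u ≡ 1
  mixed-QP {v} {u} qv pu rewrite dec-false (P? v) qv | dec-true (P? u) pu = ≡.refl

  -- The allowance of a pair: one for an inversion, one more if the pair is mixed. A mixed pair that
  -- is inverted has its Q-vertex in front in exactly one of the two words, and otherwise in both or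
  -- in neither; inversion and sinkings together never exceed 2.
  budget : A → A → ℕ
  budget v u = suc (mixed v u)

  sink-budget : ∀ v u → suc (sink u v + sink v u) ≤ budget v u
  sink-budget v u with P? v | P? u
  ... | yes _ | yes _ = ≤-refl
  ... | yes _ | no  _ = ≤-refl
  ... | no  _ | yes _ = ≤-refl
  ... | no  _ | no  _ = ≤-refl

  2sink≤budget : ∀ v u → sink v u + sink v u ≤ budget v u
  2sink≤budget v u with P? v | P? u
  ... | yes _ | yes _ = z≤n
  ... | yes _ | no  _ = z≤n
  ... | no  _ | yes _ = ≤-refl
  ... | no  _ | no  _ = z≤n

  -- Building t from the front, each new first letter v is fetched past the
  -- letters a that precede it in s.
  sort-swaps : ∀ s t → s ↭ t →
    ∃ λ k → Swaps k s t × k + (pairSum sink s + pairSum sink t) ≤ pairSum budget t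
  sort-swaps s [] p with ≡.refl ← ↭-empty-inv p = 0 , [] , z≤n
  sort-swaps s (v ∷ t) p with ∈-∃++ (∈-resp-↭ (↭-sym p) (here ≡.refl))
  ... | a , b , ≡.refl with sort-swaps (a ++ b) t (drop-mid a [] p)
  ... | k , path , k≤ =
    length a + k , Swaps-trans (Swaps-sym (moveDown v a b)) (Swaps-∷ v path) , bound
    where
    open ≤-Reasoning
    ab↭t : a ++ b ↭ t
    ab↭t = drop-mid a [] p

    split : ∀ f → sumBy f t ≡ sumBy f a + sumBy f b
    split f = ≡.trans (≡.sym (sumBy-↭ f ab↭t)) (sumBy-++ f a b)

    -- The letters of `a` are in front of `v` in `s` and behind it in `t`: one swap each, and `sink`
    -- is evaluated once in either order.
    onA : length a + (sumBy (λ u → sink u v) a + sumBy (sink v) a) ≤ sumBy (budget v) a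
    onA = begin
      length a + (sumBy (λ u → sink u v) a + sumBy (sink v) a)
        ≡⟨ cong₂ _+_ (≡.trans (≡.sym (*-identityʳ (length a))) (≡.sym (sumBy-const 1 a)))
                     (≡.sym (sumBy-+ (λ u → sink u v) (sink v) a)) ⟩
      sumBy (λ _ → 1) a + sumBy (λ u → sink u v + sink v u) a
        ≡⟨ sumBy-+ (λ _ → 1) (λ u → sink u v + sink v u) a ⟨
      sumBy (λ u → suc (sink u v + sink v u)) a
        ≤⟨ sumBy-mono (All.universal (sink-budget v) a) ⟩
      sumBy (budget v) a ∎

    -- The letters of `b` are behind `v` in both words: no swap, but `sink v` is counted twice.
    onB : sumBy (sink v) b + sumBy (sink v) b ≤ sumBy (budget v) b
    onB = begin
      sumBy (sink v) b + sumBy (sink v) b ≡⟨ sumBy-+ (sink v) (sink v) b ⟨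
      sumBy (λ u → sink v u + sink v u) b ≤⟨ sumBy-mono (All.universal (2sink≤budget v) b) ⟩
      sumBy (budget v) b                  ∎

    bound : length a + k + (pairSum sink (a ++ v ∷ b) + pairSum sink (v ∷ t))
            ≤ pairSum budget (v ∷ t)
    bound = begin
      length a + k + (pairSum sink (a ++ v ∷ b) + pairSum sink (v ∷ t))
        ≡⟨ cong₂ (λ y z → length a + k + (y + (z + pairSum sink t)))
             (pairSum-insert sink a v b) (split (sink v)) ⟩
      length a + k + (pairSum sink (a ++ b)
        + (sumBy (λ u → sink u v) a + sumBy (sink v) b)
        + (sumBy (sink v) a + sumBy (sink v) b + pairSum sink t))
        ≡⟨ solve 7 (λ l k x y z w o → l :+ k :+ (x :+ (y :+ z) :+ (w :+ z :+ o))
             := l :+ (y :+ w) :+ (z :+ z) :+ (k :+ (x :+ o))) ≡.refl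
             (length a) k (pairSum sink (a ++ b)) (sumBy (λ u → sink u v) a)
             (sumBy (sink v) b) (sumBy (sink v) a) (pairSum sink t) ⟩
      length a + (sumBy (λ u → sink u v) a + sumBy (sink v) a)
        + (sumBy (sink v) b + sumBy (sink v) b)
        + (k + (pairSum sink (a ++ b) + pairSum sink t))
        ≤⟨ +-mono-≤ (+-mono-≤ onA onB) k≤ ⟩
      sumBy (budget v) a + sumBy (budget v) b + pairSum budget t
        ≡⟨ cong (_+ pairSum budget t) (split (budget v)) ⟨
      pairSum budget (v ∷ t) ∎
      where open +-*-Solver

  Q? : Decidable (λ v → ¬ P v)
  Q? v = ¬? (P? v)

  sumBy-sink : ∀ {v} → ¬ P v → ∀ t → sumBy (sink v) t ≡ length (filter P? t)
  sumBy-sink ¬pv []      = ≡.refl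
  sumBy-sink {v} ¬pv (u ∷ t) with sumBy-sink ¬pv t
  ... | ih with P? v | P? u
  ... | yes pv | _     = contradiction pv ¬pv
  ... | no  _  | yes _ = cong suc ih
  ... | no  _  | no  _ = ih

  sumBy-sink-P : ∀ {v} → P v → ∀ t → sumBy (sink v) t ≡ 0
  sumBy-sink-P pv []      = ≡.refl
  sumBy-sink-P {v} pv (u ∷ t) with sumBy-sink-P pv t
  ... | ih with P? v
  ... | yes _  = ih
  ... | no ¬pv = contradiction pv ¬pv

  -- Once the rest has been sunk, a letter outside P passes precisely the letters of P behind it and
  -- stops in front of the other letters outside P. Hence `sink` counts exactly.
  sinkAll : ∀ w → Swaps (pairSum sink w) w (filter P? w ++ filter Q? w)
  sinkAll []      = []
  sinkAll (v ∷ t) = go (P? v)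
    where
    go : Dec (P v) →
      Swaps (pairSum sink (v ∷ t)) (v ∷ t) (filter P? (v ∷ t) ++ filter Q? (v ∷ t))
    go (yes pv)
      rewrite filter-accept P? {xs = t} pv | filter-reject Q? {xs = t} (λ ¬pv → ¬pv pv)
            | sumBy-sink-P pv t = Swaps-∷ v (sinkAll t)
    go (no ¬pv)
      rewrite filter-reject P? {xs = t} ¬pv | filter-accept Q? {xs = t} ¬pv
            | sumBy-sink ¬pv t | +-comm (length (filter P? t)) (pairSum sink t) =
      Swaps-trans (Swaps-∷ v (sinkAll t)) (moveDown v (filter P? t) (filter Q? t))

  pairSum-budget-P : ∀ {w} → All P w → pairSum budget w ≤ length w C 2
  pairSum-budget-P [] = z≤n
  pairSum-budget-P {v ∷ w} (pv ∷ pw) rewrite C2-suc (length w) =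
    +-mono-≤ (go pw) (pairSum-budget-P pw)
    where
    budget≤1 : ∀ {u} → P u → budget v u ≤ 1
    budget≤1 {u} pu with P? v | P? u
    ... | yes _  | yes _  = ≤-refl
    ... | yes _  | no ¬pu = contradiction pu ¬pu
    ... | no ¬pv | _      = contradiction pv ¬pv
    go : ∀ {u} → All P u → sumBy (budget v) u ≤ length u
    go []       = z≤n
    go (p ∷ ps) = +-mono-≤ (budget≤1 p) (go ps)

  direct-path : ∀ {s t} → s ↭ t →
    ∃ λ k → Path k s t × k + (pairSum sink s + pairSum sink t) ≤ pairSum budget t
  direct-path {s} {t} p with sort-swaps s t p
  ... | k , sw , k≤ = k , subst (λ j → Path j s t) (+-identityʳ k) (sw ++ᵖ []) , k≤

  sinking-path : ∀ {s t} → s ↭ t →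
    ∃ λ k → Path k s t × k ≤ pairSum sink s + pairSum sink t + length (filter P? t) C 2
  sinking-path {s} {t} p with sort-swaps _ _ (filter-↭ P? p)
  ... | k , sw , k≤ = _ ,
    -- The sinking of `t` is run backwards. In between only the letters of P are sorted, at no more
    -- than one swap per pair.
    (sinkAll s ++ᵖ free (≈-++ˡ (filter P? s) (tail (all-filter Q? s) (filter-↭ Q? p)))
      (Swaps-++ʳ (filter Q? t) sw ++ᵖ (Swaps-sym (sinkAll t) ++ᵖ []))) ,
    (begin
      pairSum sink s + (k + (pairSum sink t + 0))
        ≡⟨ solve 3 (λ a k b → a :+ (k :+ (b :+ con 0)) := a :+ b :+ k) ≡.refl
             (pairSum sink s) k (pairSum sink t) ⟩
      pairSum sink s + pairSum sink t + k
        ≤⟨ +-monoʳ-≤ (pairSum sink s + pairSum sink t)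
             (≤-trans (m≤m+n k _) (≤-trans k≤ (pairSum-budget-P (all-filter P? t)))) ⟩
      pairSum sink s + pairSum sink t + length (filter P? t) C 2 ∎)
    where
    open ≤-Reasoning
    open +-*-Solver

-- A potential that bounds the length of paths from below

module LowerBound {A : Set} {P : A → Set} (P? : Decidable P) (_≟_ : DecidableEquality A)
  (U : A → A → ℕ) (U≤1 : ∀ v u → U v u ≤ 1) where

  open Words P?
  open DecMembership _≟_ using (_∈?_)

  -- S collects the elements that visit the end of the word at some point of
  -- the path, and U v u = 1 says that v precedes u in the target.  charge S v u
  -- is the number of swaps still needed by the pair if now v precedes u: an
  -- element of S must pass every u ∉ S on its way to the end, and again on its
  -- way back if it precedes u in the target.
  charge : (A → Bool) → A → A → ℕ
  charge S v u = if S v then (if S u then 0 else suc (U v u)) else U u v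

  -- The leaves of the word lie in `S`: only a letter with an element of P at or after its position
  -- is excused.
  data EndIn (S : A → Bool) : List A → Set where
    []  : EndIn S []
    _∷_ : ∀ {v t} → Any P (v ∷ t) ⊎ S v ≡ true → EndIn S t → EndIn S (v ∷ t)

  Avoids : (A → Bool) → Set
  Avoids S = ∀ {v} → P v → S v ≡ false

  charge-tt : ∀ S {v u} → S v ≡ true → S u ≡ true → charge S v u ≡ 0
  charge-tt S sv su rewrite sv | su = ≡.refl

  charge-tf : ∀ S {v u} → S v ≡ true → S u ≡ false → charge S v u ≡ suc (U v u)
  charge-tf S sv su rewrite sv | su = ≡.refl

  charge-f : ∀ S {v u} → S v ≡ false → charge S v u ≡ U u v
  charge-f S sv rewrite sv = ≡.refl

  charge≡0 : ∀ S {v w} → S v ≡ true → All (λ u → S u ≡ true) w → sumBy (charge S v) w ≡ 0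
  charge≡0 S sv []        = ≡.refl
  charge≡0 S sv (su ∷ sw) = cong₂ _+_ (charge-tt S sv su) (charge≡0 S sv sw)

  pairCharge≡0 : ∀ S {w} → All (λ v → S v ≡ true) w → pairSum (charge S) w ≡ 0
  pairCharge≡0 S []        = ≡.refl
  pairCharge≡0 S (sv ∷ sw) = cong₂ _+_ (charge≡0 S sv sw) (pairCharge≡0 S sw)

  -- If `x` lies in `S` and `y` does not, the two charges are `suc (U x y)` and `U x y`. In all
  -- other cases the left one is at most 1.
  charge-swap : ∀ S x y → charge S x y ≤ suc (charge S y x)
  charge-swap S x y with S x | S y
  ... | true  | true  = z≤n
  ... | true  | false = ≤-refl
  ... | false | true  = ≤-trans (U≤1 y x) (s≤s z≤n)
  ... | false | false = ≤-trans (U≤1 y x) (s≤s z≤n)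

  -- A new member of `S` never makes the letters in front of it more expensive: for `v` in `S` the
  -- charge drops to 0, and for `v` outside `S` it ignores whether `u` is in `S`. This is what lets
  -- the set grow along the path.
  charge-anti : ∀ S S₁ {v u} → S v ≡ S₁ v → (S₁ u ≡ true → S u ≡ true) →
    charge S v u ≤ charge S₁ v u
  charge-anti S S₁ {v} {u} eq inc rewrite eq with S₁ v | S₁ u | S u
  ... | false | _     | _     = ≤-refl
  ... | true  | true  | true  = z≤n
  ... | true  | true  | false with () ← inc ≡.refl
  ... | true  | false | true  = z≤n
  ... | true  | false | false = ≤-refl

  end⇒all : ∀ {S w} → ¬ Any P w → EndIn S w → All (λ v → S v ≡ true) w
  end⇒all np []            = []
  end⇒all np (inj₁ p ∷ e)  = contradiction p np
  end⇒all np (inj₂ sv ∷ e) = sv ∷ end⇒all (λ p → np (there p)) e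

  all⇒end : ∀ {S w} → All (λ v → S v ≡ true) w → EndIn S w
  all⇒end []        = []
  all⇒end (sv ∷ sw) = inj₂ sv ∷ all⇒end sw

  -- Leaves lie in `S` and pairs inside `S` carry no charge, so the order of the leaves is
  -- invisible; the letters in front see only which letters are behind them.
  free-step : ∀ {S s t} → s ≈ t → EndIn S t →
    EndIn S s × pairSum (charge S) s ≡ pairSum (charge S) t
  free-step {S} (tail np p) e =
    all⇒end all-s , ≡.trans (pairCharge≡0 S all-s) (≡.sym (pairCharge≡0 S all-t))
    where
    all-t = end⇒all (All¬⇒¬Any (All-resp-↭ p np)) e
    all-s = All-resp-↭ (↭-sym p) all-t
  free-step {S} (v ∷ p) (pv ∷ e) with free-step p e
  ... | e′ , eq = here-v pv ∷ e′ , cong₂ _+_ (sumBy-↭ (charge S v) (≈⇒↭ p)) eq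
    where
    here-v : Any P (v ∷ _) ⊎ S v ≡ true → Any P (v ∷ _) ⊎ S v ≡ true
    here-v (inj₁ q) = inj₁ (Any-resp-↭ (↭-sym (prep v (≈⇒↭ p))) q)
    here-v (inj₂ q) = inj₂ q

  swap-bound : ∀ S x y s →
    pairSum (charge S) (x ∷ y ∷ s) ≤ suc (pairSum (charge S) (y ∷ x ∷ s))
  swap-bound S x y s = begin
    charge S x y + sumBy (charge S x) s + (sumBy (charge S y) s + pairSum (charge S) s)
      ≤⟨ +-monoˡ-≤ _ (+-monoˡ-≤ _ (charge-swap S x y)) ⟩
    suc (charge S y x) + sumBy (charge S x) s + (sumBy (charge S y) s + pairSum (charge S) s)
      ≡⟨ solve 4 (λ c a b d → c :+ a :+ (b :+ d) := c :+ b :+ (a :+ d)) ≡.refl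
           (suc (charge S y x)) (sumBy (charge S x) s) (sumBy (charge S y) s)
           (pairSum (charge S) s) ⟩
    suc (charge S y x + sumBy (charge S y) s + (sumBy (charge S x) s + pairSum (charge S) s)) ∎
    where
    open ≤-Reasoning
    open +-*-Solver

  insert : A → (A → Bool) → A → Bool
  insert y S v = does (v ≟ y) ∨ S v

  -- Going back from `t` to `s`, a letter turns into a leaf only when the last element of P moves
  -- from behind it to its front, and then only this letter is added. Agreement of `S` and `S₁` off
  -- `s` keeps the status of a letter prepended to both words, as `charge-anti` requires.
  swap-step : ∀ {s t} → s ⇄ t → Unique s → ∀ {S₁} → Avoids S₁ → EndIn S₁ t →
    ∃ λ S → Avoids S × (∀ {v} → S₁ v ≡ true → S v ≡ true) × (∀ {v} → v ∉ s → S v ≡ S₁ v)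
      × EndIn S s × pairSum (charge S) s ≤ suc (pairSum (charge S₁) t)
  swap-step (here {x} {y} {s}) uniq {S₁} av (ey ∷ ex ∷ e) with Any.any? P? (y ∷ s) | P? x
  -- Entering `S` could raise the charges of `y`, but all letters behind it in the word are leaves
  -- and lie in `S`, so these charges vanish. What is left is the pair of `x` and `y`, worth at most
  -- 1, and the charges of `x`, which do not increase.
  ... | no np | yes px = S , avoids , grows , same , (inj₁ (here px) ∷ all⇒end (sy ∷ all-s)) ,
    (begin
      charge S x y + sumBy (charge S x) s + (sumBy (charge S y) s + pairSum (charge S) s)
        ≡⟨ cong₂ (λ a b → charge S x y + sumBy (charge S x) s + (a + b))
             (charge≡0 S sy all-s) (pairCharge≡0 S all-s) ⟩
      charge S x y + sumBy (charge S x) s + 0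
        ≡⟨ +-identityʳ _ ⟩
      charge S x y + sumBy (charge S x) s
        ≤⟨ +-mono-≤ (≤-trans (≤-reflexive (charge-f S sx)) (U≤1 y x))
             (sumBy-mono (All.universal (λ u → charge-anti S S₁ (same-x) grows) s)) ⟩
      suc (sumBy (charge S₁ x) s)
        ≤⟨ s≤s (≤-trans (m≤m+n _ (pairSum (charge S₁) s)) (m≤n+m _ (sumBy (charge S₁ y) (x ∷ s)))) ⟩
      suc (sumBy (charge S₁ y) (x ∷ s) + (sumBy (charge S₁ x) s + pairSum (charge S₁) s)) ∎)
    where
    open ≤-Reasoning
    S = insert y S₁
    x≢y : x ≢ y
    x≢y ≡.refl = np (here px)
    avoids : Avoids S
    avoids {v} pv with v ≟ y
    ... | yes ≡.refl = contradiction (here pv) np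
    ... | no  _      = av pv
    grows : ∀ {v} → S₁ v ≡ true → S v ≡ true
    grows {v} sv rewrite sv = ∨-zeroʳ (does (v ≟ y))
    same : ∀ {v} → v ∉ x ∷ y ∷ s → S v ≡ S₁ v
    same {v} v∉ rewrite dec-false (v ≟ y) (λ { ≡.refl → v∉ (there (here ≡.refl)) }) = ≡.refl
    same-x : S x ≡ S₁ x
    same-x rewrite dec-false (x ≟ y) x≢y = ≡.refl
    sx : S x ≡ false
    sx = avoids px
    sy : S y ≡ true
    sy rewrite dec-true (y ≟ y) ≡.refl = ≡.refl
    all-s : All (λ v → S v ≡ true) s
    all-s = All.map grows (end⇒all (λ p → np (there p)) e)
  ... | yes p | _ =
    S₁ , av , (λ q → q) , (λ _ → ≡.refl) , (inj₁ (there p) ∷ inj₁ p ∷ e) , swap-bound S₁ x y s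
  ... | no np | no ¬px =
    S₁ , av , (λ q → q) , (λ _ → ≡.refl) , all⇒end (All-resp-↭ (swap y x refl) all-yx) ,
    swap-bound S₁ x y s
    where
    all-yx : All (λ v → S₁ v ≡ true) (y ∷ x ∷ s)
    all-yx = end⇒all
      (λ { (here py) → np (here py) ; (there (here px)) → ¬px px
         ; (there (there ps)) → np (there ps) }) (ey ∷ ex ∷ e)
  swap-step (there a {s} {t} p) (a∉s ∷ uniq) {S₁} av (ea ∷ e) with swap-step p uniq av e
  ... | S , avoids , grows , same , e′ , bound =
    S , avoids , grows , (λ v∉ → same (λ q → v∉ (there q))) , (here-a ea ∷ e′) ,
    (begin
      sumBy (charge S a) s + pairSum (charge S) s
        ≤⟨ +-mono-≤ (sumBy-mono (All.universal (λ u → charge-anti S S₁ same-a grows) s)) bound ⟩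
      sumBy (charge S₁ a) s + suc (pairSum (charge S₁) t)
        ≡⟨ cong (_+ suc (pairSum (charge S₁) t)) (sumBy-↭ (charge S₁ a) (⇄⇒↭ p)) ⟩
      sumBy (charge S₁ a) t + suc (pairSum (charge S₁) t)
        ≡⟨ +-suc _ _ ⟩
      suc (sumBy (charge S₁ a) t + pairSum (charge S₁) t) ∎)
    where
    open ≤-Reasoning
    same-a : S a ≡ S₁ a
    same-a = same (λ a∈s → All.lookup a∉s a∈s ≡.refl)
    here-a : Any P (a ∷ t) ⊎ S₁ a ≡ true → Any P (a ∷ s) ⊎ S a ≡ true
    here-a (inj₁ q) = inj₁ (Any-resp-↭ (↭-sym (prep a (⇄⇒↭ p))) q)
    here-a (inj₂ q) = inj₂ (grows q)

  witness : ∀ {X : Set} (d : Dec X) → does d ≡ true → X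
  witness (yes x) _ = x

  -- The set starts as the leaves of the target. A letter that is no leaf is outside it, so its
  -- charge counts later letters that belong in front of it, and there are none.
  base-step : ∀ {u} → Unique u → AllPairs (λ v v′ → U v′ v ≡ 0) u →
    ∃ λ S → Avoids S × (∀ {v} → S v ≡ true → v ∈ u) × EndIn S u × pairSum (charge S) u ≡ 0
  base-step [] [] = (λ _ → false) , (λ _ → ≡.refl) , (λ ()) , [] , ≡.refl
  base-step {v ∷ t} (v∉t ∷ uniq) (before ∷ sorted) with Any.any? P? (v ∷ t)
  ... | yes p = let S , avoids , listed , e , zero-sum = base-step uniq sorted in
    S , avoids , (λ q → there (listed q)) , (inj₁ p ∷ e) ,
    cong₂ _+_ (no-charge S (not-true (λ sv → All.lookup v∉t (listed sv) ≡.refl)) before) zero-sum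
    where
    not-true : ∀ {b} → b ≢ true → b ≡ false
    not-true {false} _ = ≡.refl
    not-true {true}  q = contradiction ≡.refl q
    no-charge : ∀ S {r} → S v ≡ false → All (λ u → U u v ≡ 0) r → sumBy (charge S v) r ≡ 0
    no-charge S sv []       = ≡.refl
    no-charge S sv (q ∷ qs) = cong₂ _+_ (≡.trans (charge-f S sv) q) (no-charge S sv qs)
  ... | no np = S , avoids , listed , all⇒end all-u , pairCharge≡0 S all-u
    where
    S : A → Bool
    S u = does (u ∈? (v ∷ t))
    listed : ∀ {u} → S u ≡ true → u ∈ v ∷ t
    listed {u} = witness (u ∈? (v ∷ t))
    avoids : Avoids S
    avoids {u} pu = dec-false (u ∈? (v ∷ t)) (λ u∈ → np (Any.map (λ { ≡.refl → pu }) u∈))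
    all-u : All (λ u → S u ≡ true) (v ∷ t)
    all-u = All.tabulate (λ {u} u∈ → dec-true (u ∈? (v ∷ t)) u∈)

  path-bound : ∀ {k w u} → Path k w u → Unique w → AllPairs (λ v v′ → U v′ v ≡ 0) u →
    ∃ λ S → Avoids S × EndIn S w × pairSum (charge S) w ≤ k
  path-bound [] uniq sorted =
    let S , avoids , _ , e , eq = base-step uniq sorted in S , avoids , e , ≤-reflexive eq
  path-bound (free p ps) uniq sorted =
    let S , avoids , e , bound = path-bound ps (Unique-resp-↭ (≈⇒↭ p) uniq) sorted
        e′ , eq = free-step p e
    in S , avoids , e′ , ≤-trans (≤-reflexive eq) bound
  path-bound (swap p ps) uniq sorted =
    let S₁ , av , e , bound = path-bound ps (Unique-resp-↭ (⇄⇒↭ p) uniq) sorted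
        S , avoids , _ , _ , e′ , bound′ = swap-step p uniq av e
    in S , avoids , e′ , ≤-trans bound′ (s≤s bound)

-- Vertex sets of trees

x∈p─q⇒x∉q : ∀ {n} {x : Fin n} (p q : Subset n) → x ∈ˢ p ─ q → x ∉ˢ q
x∈p─q⇒x∉q (_ ∷ p) (outside ∷ q) (thereᵛ x∈) (thereᵛ x∈q) = x∈p─q⇒x∉q p q x∈ x∈q
x∈p─q⇒x∉q (_ ∷ p) (inside  ∷ q) (thereᵛ x∈) (thereᵛ x∈q) = x∈p─q⇒x∉q p q x∈ x∈q

x∈p-y⇒x≢y : ∀ {n} {x y : Fin n} (p : Subset n) → x ∈ˢ p - y → x ≢ y
x∈p-y⇒x≢y p x∈ ≡.refl = x∈p─q⇒x∉q p _ x∈ (x∈⁅x⁆ _)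

∈-verts⁺ : ∀ {n} {x : Fin n} ts → Any (λ c → x ∈ˢ verts c) ts → x ∈ˢ ⋃ (vertsList ts)
∈-verts⁺ (t ∷ ts) (here p)  = x∈p∪q⁺ (inj₁ p)
∈-verts⁺ (t ∷ ts) (there p) = x∈p∪q⁺ (inj₂ (∈-verts⁺ ts p))

∈-verts⁻ : ∀ {n} {x : Fin n} ts → x ∈ˢ ⋃ (vertsList ts) → Any (λ c → x ∈ˢ verts c) ts
∈-verts⁻ []       x∈ = contradiction x∈ ∉⊥
∈-verts⁻ (t ∷ ts) x∈ with x∈p∪q⁻ (verts t) (⋃ (vertsList ts)) x∈
... | inj₁ p = here p
... | inj₂ p = there (∈-verts⁻ ts p)

root∈verts : ∀ {n} (r : Fin n) ts → r ∈ˢ verts (node r ts)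
root∈verts r ts = x∈p∪q⁺ (inj₁ (x∈⁅x⁆ r))

pattern leaf v = node v []

verts-leaf : ∀ {n} (v : Fin n) → verts (leaf v) ≡ ⁅ v ⁆
verts-leaf v = ∪-identityʳ ⁅ v ⁆

∈-leaf : ∀ {n} {x : Fin n} v → x ∈ˢ verts (leaf v) → x ≡ v
∈-leaf v x∈ = x∈⁅y⁆⇒x≡y v (subst (_ ∈ˢ_) (verts-leaf v) x∈)

appendL≡++ : ∀ {n} (xs ys : List (Subset n)) → appendL xs ys ≡ xs ++ ys
appendL≡++ []       ys = ≡.refl
appendL≡++ (x ∷ xs) ys = cong (x ∷_) (appendL≡++ xs ys)

-- Tubes of words, and rotations as swaps

module Trees {n : ℕ} {P : Fin n → Set} (P? : Decidable P) where

  open Words P?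

  G : Graph n
  Adj G u v = u ≢ v × (P u ⊎ P v)

  hasP? : Decidable (Any P)
  hasP? = Any.any? P?

  -- A word lists the vertices from the root downwards; the letters after the
  -- last element of P are the leaves below it.
  forest : List (Fin n) → List (Tree n)
  forest []      = []
  forest (v ∷ t) = if does (hasP? (v ∷ t)) then [ node v (forest t) ] else leaf v ∷ forest t

  data Represents : List (Fin n) → Tree n → Set where
    rep : ∀ {v t} → Represents (v ∷ t) (node v (forest t))

  forest-P : ∀ {v t} → Any P (v ∷ t) → forest (v ∷ t) ≡ [ node v (forest t) ]
  forest-P {v} {t} p rewrite dec-true (hasP? (v ∷ t)) p = ≡.refl

  forest-¬P : ∀ {t} → ¬ Any P t → forest t ≡ map (λ v → leaf v) t
  forest-¬P {[]}    np = ≡.refl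
  forest-¬P {v ∷ t} np rewrite dec-false (hasP? (v ∷ t)) np =
    cong (leaf v ∷_) (forest-¬P (λ p → np (there p)))

  ∈-forest⁺ : ∀ {x} t → x ∈ t → Any (λ c → x ∈ˢ verts c) (forest t)
  ∈-node⁺ : ∀ {x} v t → x ∈ v ∷ t → x ∈ˢ verts (node v (forest t))

  ∈-node⁺ v t (here ≡.refl) = root∈verts v (forest t)
  ∈-node⁺ v t (there x∈)    = x∈p∪q⁺ (inj₂ (∈-verts⁺ (forest t) (∈-forest⁺ t x∈)))

  ∈-forest⁺ {x} (v ∷ t) x∈ with hasP? (v ∷ t)
  ... | yes p rewrite forest-P p = here (∈-node⁺ v t x∈)
  ... | no np rewrite forest-¬P np =
    AnyP.map⁺ (Any.map (λ { ≡.refl → root∈verts x [] }) x∈)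

  ∈-forest⁻ : ∀ {x} t → Any (λ c → x ∈ˢ verts c) (forest t) → x ∈ t
  ∈-node⁻ : ∀ {x} v t → x ∈ˢ verts (node v (forest t)) → x ∈ v ∷ t

  ∈-node⁻ v t x∈ with x∈p∪q⁻ ⁅ v ⁆ (⋃ (vertsList (forest t))) x∈
  ... | inj₁ p = here (x∈⁅y⁆⇒x≡y v p)
  ... | inj₂ p = there (∈-forest⁻ t (∈-verts⁻ (forest t) p))

  ∈-forest⁻ (v ∷ t) x∈ with hasP? (v ∷ t)
  ... | yes p with here q ← subst (Any _) (forest-P p) x∈ = ∈-node⁻ v t q
  ... | no np = Any.map (λ {y} q → ∈-leaf y q) (AnyP.map⁻ (subst (Any _) (forest-¬P np) x∈))

  -- The vertex set of the subtree rooted at v when t is what follows v.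
  top : Fin n → List (Fin n) → Subset n
  top v t = if does (hasP? (v ∷ t)) then verts (node v (forest t)) else verts (leaf v)

  top-P : ∀ {v t} → Any P (v ∷ t) → top v t ≡ verts (node v (forest t))
  top-P {v} {t} p rewrite dec-true (hasP? (v ∷ t)) p = ≡.refl

  top-¬P : ∀ {v t} → ¬ Any P (v ∷ t) → top v t ≡ verts (leaf v)
  top-¬P {v} {t} np rewrite dec-false (hasP? (v ∷ t)) np = ≡.refl

  ∈-top : ∀ v t → v ∈ˢ top v t
  ∈-top v t with does (hasP? (v ∷ t))
  ... | true  = root∈verts v (forest t)
  ... | false = root∈verts v []

  ∈-top-P : ∀ {v t x} → Any P (v ∷ t) → x ∈ v ∷ t → x ∈ˢ top v t
  ∈-top-P {v} {t} p x∈ rewrite top-P p = ∈-node⁺ v t x∈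

  top⊆ : ∀ {x} v t → x ∈ˢ top v t → x ∈ v ∷ t
  top⊆ v t x∈ with hasP? (v ∷ t)
  ... | yes p rewrite top-P p  = ∈-node⁻ v t x∈
  ... | no np rewrite top-¬P np = here (∈-leaf v x∈)

  -- As long as an element of P is left, the tube consists of all remaining letters, whatever their
  -- order.
  top-↭ : ∀ {x y s t} → Any P (x ∷ s) → x ∷ s ↭ y ∷ t → top x s ≡ top y t
  top-↭ {x} {y} {s} {t} p xs↭yt = ⊆-antisym
    (λ q → ∈-top-P (Any-resp-↭ xs↭yt p) (∈-resp-↭ xs↭yt (top⊆ x s q)))
    (λ q → ∈-top-P p (∈-resp-↭ (↭-sym xs↭yt) (top⊆ y t q)))

  top-cong : ∀ v {s t} → s ↭ t → top v s ≡ top v t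
  top-cong v {s} {t} p with hasP? (v ∷ s)
  ... | yes q = top-↭ q (prep v p)
  ... | no nq = ≡.trans (top-¬P nq)
    (≡.sym (top-¬P (λ q → nq (Any-resp-↭ (↭-sym (prep v p)) q))))

  data Tube : List (Fin n) → Subset n → Set where
    here  : ∀ {v t X} → X ≡ top v t → Tube (v ∷ t) X
    there : ∀ {v t X} → Tube t X → Tube (v ∷ t) X

  tube? : ∀ w X → Dec (Tube w X)
  tube? []      X = no λ ()
  tube? (v ∷ t) X with ≡-decᵛ _≟ᵇ_ X (top v t) | tube? t X
  ... | yes p | _     = yes (here p)
  ... | no _  | yes q = yes (there q)
  ... | no ¬p | no ¬q = no λ { (here p) → ¬p p ; (there q) → ¬q q }

  tubesList-forest : ∀ v t → tubesList (forest (v ∷ t)) ≡ top v t ∷ tubesList (forest t)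
  tubesList-forest v t with hasP? (v ∷ t)
  ... | yes p rewrite top-P p | forest-P p =
    cong (verts (node v (forest t)) ∷_) (≡.trans (appendL≡++ _ []) (++-identityʳ _))
  ... | no np rewrite top-¬P np | forest-¬P np | forest-¬P {t} (λ q → np (there q)) = ≡.refl

  tube⁺ : ∀ {X} t → Tube t X → X ∈ tubesList (forest t)
  tube⁺ (v ∷ t) p rewrite tubesList-forest v t with p
  ... | here eq = here eq
  ... | there q = there (tube⁺ t q)

  tube⁻ : ∀ {X} t → X ∈ tubesList (forest t) → Tube t X
  tube⁻ (v ∷ t) p rewrite tubesList-forest v t with p
  ... | here eq = here eq
  ... | there q = there (tube⁻ t q)

  tubes⇔ : ∀ {w T X} → Any P w → Represents w T → X ∈ tubes T ⇔ Tube w X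
  tubes⇔ p (rep {v} {t}) = mk⇔
    (λ { (here eq) → here (≡.trans eq (≡.sym (top-P p))) ; (there q) → there (tube⁻ t q) })
    (λ { (here eq) → here (≡.trans eq (top-P p)) ; (there q) → there (tube⁺ t q) })

  tube⊆ : ∀ {w X x} → Tube w X → x ∈ˢ X → x ∈ w
  tube⊆ {v ∷ t} (here ≡.refl) x∈ = top⊆ v t x∈
  tube⊆ (there q) x∈             = there (tube⊆ q x∈)

  tube∋ : ∀ {w x} → x ∈ w → ∃ λ X → Tube w X × x ∈ˢ X
  tube∋ {v ∷ t} (here ≡.refl) = top v t , here ≡.refl , ∈-top v t
  tube∋ {v ∷ t} (there x∈) = let X , q , x∈X = tube∋ x∈ in X , there q , x∈X

  tube-leaf⁻ : ∀ {w X} → ¬ Any P w → Tube w X → ∃ λ v → v ∈ w × X ≡ verts (leaf v)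
  tube-leaf⁻ np (here eq) = _ , here ≡.refl , ≡.trans eq (top-¬P np)
  tube-leaf⁻ np (there q) =
    let v , v∈ , eq = tube-leaf⁻ (λ p → np (there p)) q in v , there v∈ , eq

  tube-leaf⁺ : ∀ {w v} → ¬ Any P w → v ∈ w → Tube w (verts (leaf v))
  tube-leaf⁺ np (here ≡.refl) = here (≡.sym (top-¬P np))
  tube-leaf⁺ np (there v∈)    = there (tube-leaf⁺ (λ p → np (there p)) v∈)

  ≈⇒tube : ∀ {s t X} → s ≈ t → Tube s X → Tube t X
  ≈⇒tube (tail np p) q with tube-leaf⁻ (All¬⇒¬Any np) q
  ... | v , v∈ , ≡.refl = tube-leaf⁺ (All¬⇒¬Any (All-resp-↭ p np)) (∈-resp-↭ p v∈)
  ≈⇒tube (v ∷ p) (here eq) = here (≡.trans eq (top-cong v (≈⇒↭ p)))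
  ≈⇒tube (v ∷ p) (there q) = there (≈⇒tube p q)

  Lost : List (Fin n) → List (Fin n) → Subset n → Set
  Lost s t X = Tube s X × ¬ Tube t X

  Differ : List (Fin n) → List (Fin n) → Subset n → Set
  Differ s t X = Lost s t X ⊎ Lost t s X

  Rotates : List (Fin n) → List (Fin n) → Set
  Rotates s t = ∃ λ A → ∃ λ B → A ≢ B × Differ s t A × Differ s t B ×
    (∀ X → Differ s t X → X ≡ A ⊎ X ≡ B)

  lost-∷⁺ : ∀ {v s t X} → v ∉ s → Lost s t X → Lost (v ∷ s) (v ∷ t) X
  lost-∷⁺ {v} {s} {t} v∉s (q , nq) = there q , λ
    { (here ≡.refl) → v∉s (tube⊆ q (∈-top v t)) ; (there r) → nq r }

  -- The tube of the common first letter depends only on the set of letters behind it, so it is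
  -- never lost. Symmetric differences can thus be studied from the first place where two words
  -- differ.
  lost-∷⁻ : ∀ {v s t X} → s ↭ t → Lost (v ∷ s) (v ∷ t) X → Lost s t X
  lost-∷⁻ {v} p (here eq , nq) = contradiction (here (≡.trans eq (top-cong v p))) nq
  lost-∷⁻     p (there q , nq) = q , λ r → nq (there r)

  module _ {v : Fin n} {s t : List (Fin n)} (v∉s : v ∉ s) (p : s ↭ t) where

    private
      v∉t : v ∉ t
      v∉t v∈ = v∉s (∈-resp-↭ (↭-sym p) v∈)

    differ-∷⁺ : ∀ {X} → Differ s t X → Differ (v ∷ s) (v ∷ t) X
    differ-∷⁺ (inj₁ l) = inj₁ (lost-∷⁺ v∉s l)
    differ-∷⁺ (inj₂ l) = inj₂ (lost-∷⁺ v∉t l)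

    differ-∷⁻ : ∀ {X} → Differ (v ∷ s) (v ∷ t) X → Differ s t X
    differ-∷⁻ (inj₁ l) = inj₁ (lost-∷⁻ p l)
    differ-∷⁻ (inj₂ l) = inj₂ (lost-∷⁻ (↭-sym p) l)

    rotates-∷⁺ : Rotates s t → Rotates (v ∷ s) (v ∷ t)
    rotates-∷⁺ (A , B , A≢B , dA , dB , only) =
      A , B , A≢B , differ-∷⁺ dA , differ-∷⁺ dB , λ X d → only X (differ-∷⁻ d)

    rotates-∷⁻ : Rotates (v ∷ s) (v ∷ t) → Rotates s t
    rotates-∷⁻ (A , B , A≢B , dA , dB , only) =
      A , B , A≢B , differ-∷⁻ dA , differ-∷⁻ dB , λ X d → only X (differ-∷⁺ d)

  lost-swap : ∀ {x y s} → Any P (x ∷ y ∷ s) → Unique (x ∷ y ∷ s) →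
    Lost (x ∷ y ∷ s) (y ∷ x ∷ s) (top y s)
  lost-swap {x} {y} {s} p ((x≢y ∷ x∉s) ∷ y∉s ∷ _) = there (here ≡.refl) , λ
    { (here eq) → x∉top (subst (x ∈ˢ_) (≡.sym eq)
        (∈-top-P (Any-resp-↭ (swap x y refl) p) (there (here ≡.refl))))
    ; (there (here eq)) → x∉top (subst (x ∈ˢ_) (≡.sym eq) (∈-top x s))
    ; (there (there q)) → All.lookup y∉s (tube⊆ q (∈-top y s)) ≡.refl }
    where
    x∉top : ¬ x ∈ˢ top y s
    x∉top x∈ with top⊆ y s x∈
    ... | here eq   = x≢y eq
    ... | there x∈s = All.lookup x∉s x∈s ≡.refl

  only-swap : ∀ {x y s X} → Any P (x ∷ y ∷ s) → Lost (x ∷ y ∷ s) (y ∷ x ∷ s) X → X ≡ top y s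
  only-swap p (here eq , nq)         =
    contradiction (here (≡.trans eq (top-↭ p (swap _ _ refl)))) nq
  only-swap p (there (here eq) , nq) = eq
  only-swap p (there (there q) , nq) = contradiction (there (there q)) nq

  -- With an element of P at or behind the swapped letters, `top y s` is exchanged for `top x s` and
  -- every other tube stays. Otherwise both letters are leaves and nothing changes.
  ⇄⇒rotates : ∀ {s t} → s ⇄ t → Unique s → s ≈ t ⊎ Rotates s t
  ⇄⇒rotates (here {x} {y} {s}) uniq with hasP? (x ∷ y ∷ s)
  ... | no np = inj₁ (tail (¬Any⇒All¬ _ np) (swap x y refl))
  ... | yes p = inj₂ (top y s , top x s , y≢x ,
      inj₁ (lost-swap p uniq) , inj₂ (lost-swap p′ uniq′) ,
      λ X → λ { (inj₁ l) → inj₁ (only-swap p l) ; (inj₂ l) → inj₂ (only-swap p′ l) })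
    where
    p′     = Any-resp-↭ (swap x y refl) p
    uniq′  = Unique-resp-↭ (swap x y refl) uniq
    y≢x : top y s ≢ top x s
    y≢x eq = proj₂ (lost-swap p uniq) (there (here eq))
  ⇄⇒rotates (there v p) (v∉ ∷ uniq) with ⇄⇒rotates p uniq
  ... | inj₁ q = inj₁ (v ∷ q)
  ... | inj₂ r = inj₂ (rotates-∷⁺ (λ v∈ → All.lookup v∉ v∈ ≡.refl) (⇄⇒↭ p) r)

  head∉ : ∀ {v t} → Unique {A = Fin n} (v ∷ t) → v ∉ t
  head∉ (v∉ ∷ _) v∈ = All.lookup v∉ v∈ ≡.refl

  ∈-tail : ∀ {x y} {t : List (Fin n)} → x ≢ y → x ∈ y ∷ t → x ∈ t
  ∈-tail x≢y (here eq) = contradiction eq x≢y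
  ∈-tail x≢y (there q) = q

  -- If an element of P were left and another letter `z` stood first, then `y` would lie in the tube
  -- of `z` and also in a tube of the rest, which misses `z`. So `y` is first already, or all
  -- letters are leaves and it may be moved there.
  toFront : ∀ {y s} → Unique s → y ∈ s →
    (∀ {X Y} → Tube s X → y ∈ˢ X → Tube s Y → y ∈ˢ Y → X ≡ Y) → ∃ λ r → s ≈ y ∷ r
  toFront {s = z ∷ s} us (here ≡.refl) unique = s , ≈-refl
  toFront {s = z ∷ s} us (there y∈s)   unique with hasP? (z ∷ s)
  ... | yes h = let Y , q , y∈Y = tube∋ y∈s in contradiction
    (tube⊆ q (subst (z ∈ˢ_) (unique (here ≡.refl) (∈-top-P h (there y∈s)) (there q) y∈Y)
      (∈-top z s)))
    (head∉ us)
  ... | no nh with ∈-∃++ y∈s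
  ...   | a , b , ≡.refl =
    z ∷ a ++ b , tail (¬Any⇒All¬ _ nh) (trans (prep z (shift _ a b)) (swap _ _ refl))

  module Heads {x y s t} (ux : Unique (x ∷ s)) (uy : Unique (y ∷ t)) (p : x ∷ s ↭ y ∷ t)
    (x≢y : x ≢ y) (hasP : Any P (x ∷ s)) where

    -- The first tube of `y ∷ t` contains `x`, which is absent from `s`, and the later ones miss
    -- `y`.
    lost : ∀ {X} → Tube s X → y ∈ˢ X → Lost (x ∷ s) (y ∷ t) X
    lost q y∈X = there q , λ
      { (here ≡.refl) → head∉ ux (tube⊆ q
          (∈-top-P (Any-resp-↭ p hasP) (∈-resp-↭ p (here ≡.refl))))
      ; (there r) → head∉ uy (tube⊆ r y∈X) }

    lost∃ : ∃ λ X → Tube s X × y ∈ˢ X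
    lost∃ = tube∋ (∈-tail (λ eq → x≢y (≡.sym eq)) (∈-resp-↭ (↭-sym p) (here ≡.refl)))

    front : (∀ {X Y} → Tube s X → y ∈ˢ X → Tube s Y → y ∈ˢ Y → X ≡ Y) → ∃ λ r → s ≈ y ∷ r
    front = toFront (AllPairs.tail ux)
      (∈-tail (λ eq → x≢y (≡.sym eq)) (∈-resp-↭ (↭-sym p) (here ≡.refl)))

  sameTubes⇒≈ : ∀ {s t} → Unique s → Unique t → s ↭ t →
    (∀ {X} → Tube s X → Tube t X) → s ≈ t
  sameTubes⇒≈ {[]}    {_}     us ut p same = tail [] p
  sameTubes⇒≈ {x ∷ s} {[]}    us ut p same = contradiction p ¬x∷xs↭[]
  sameTubes⇒≈ {x ∷ s} {y ∷ t} us@(_ ∷ us′) ut@(_ ∷ ut′) p same with hasP? (x ∷ s) | x ≟ y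
  ... | no np | _          = tail (¬Any⇒All¬ _ np) p
  ... | yes h | yes ≡.refl = x ∷ sameTubes⇒≈ us′ ut′ (drop-∷ p) λ q → drop-head q (same (there q))
    where
    drop-head : ∀ {X} → Tube s X → Tube (x ∷ t) X → Tube t X
    drop-head q (here ≡.refl) = contradiction (tube⊆ q (∈-top x t)) (head∉ us)
    drop-head q (there r)     = r
  ... | yes h | no x≢y     =
    let open Heads us ut p x≢y h ; X , q , y∈X = lost∃ in
    contradiction (same (there q)) (proj₂ (lost q y∈X))

  path-∷ : ∀ v {k s t} → Path k s t → Path k (v ∷ s) (v ∷ t)
  path-∷ v []          = []
  path-∷ v (free p ps) = free (v ∷ p) (path-∷ v ps)
  path-∷ v (swap p ps) = swap (there v p) (path-∷ v ps)

  third : ∀ {Z : Set} {Q : Z → Set} {A B K D E : Z} → (∀ X → Q X → X ≡ A ⊎ X ≡ B) →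
    Q K → Q D → K ≢ D → Q E → E ≡ K ⊎ E ≡ D
  third only c d K≢D e with only _ c | only _ d | only _ e
  ... | inj₁ ≡.refl | inj₁ ≡.refl | _           = contradiction ≡.refl K≢D
  ... | inj₂ ≡.refl | inj₂ ≡.refl | _           = contradiction ≡.refl K≢D
  ... | inj₁ ≡.refl | inj₂ ≡.refl | eq          = eq
  ... | inj₂ ≡.refl | inj₁ ≡.refl | inj₁ eq     = inj₂ eq
  ... | inj₂ ≡.refl | inj₁ ≡.refl | inj₂ eq     = inj₁ eq

  -- At the first disagreement, `x` against `y`, every tube of `s` with `y` and every tube of `t`
  -- with `x` is lost by its word. Only two tubes differ, so there is one of each kind, `B` and `K`.
  -- By `toFront`, `y` can be brought forward in `s` and `x` in `t`; one swap of the two remains,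
  -- and the rests have the same tubes.
  rotates⇒path : ∀ {s t} → Unique s → Unique t → s ↭ t → Rotates s t → Path 1 s t
  rotates⇒path {[]} us ut p rot with ≡.refl ← ↭-empty-inv (↭-sym p)
    with rot
  ... | _ , _ , _ , inj₁ (() , _) , _
  ... | _ , _ , _ , inj₂ (() , _) , _
  rotates⇒path {x ∷ s} {[]} us ut p rot = contradiction p ¬x∷xs↭[]
  rotates⇒path {x ∷ s} {y ∷ t} us@(x∉s ∷ us′) ut@(_ ∷ ut′) p rot with hasP? (x ∷ s) | x ≟ y
  ... | no np | _ = contradiction rot λ
    { (_ , _ , _ , inj₁ (q , nq) , _) → nq (≈⇒tube s≈t q)
    ; (_ , _ , _ , inj₂ (q , nq) , _) → nq (≈⇒tube (≈-sym s≈t) q) }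
    where
    s≈t : x ∷ s ≈ y ∷ t
    s≈t = tail (¬Any⇒All¬ _ np) p
  ... | yes h | yes ≡.refl =
    path-∷ x (rotates⇒path us′ ut′ (drop-∷ p) (rotates-∷⁻ (head∉ us) (drop-∷ p) rot))
  ... | yes h | no x≢y = path
    where
    only = proj₂ (proj₂ (proj₂ (proj₂ (proj₂ rot))))
    module L = Heads us ut p x≢y h
    module R = Heads ut us (↭-sym p) (λ eq → x≢y (≡.sym eq)) (Any-resp-↭ p h)
    B = proj₁ L.lost∃
    K = proj₁ R.lost∃
    B-tube = proj₁ (proj₂ L.lost∃)
    K-tube = proj₁ (proj₂ R.lost∃)
    y∈B = proj₂ (proj₂ L.lost∃)
    x∈K = proj₂ (proj₂ R.lost∃)
    B≢K : B ≢ K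
    B≢K eq = head∉ us (tube⊆ B-tube (subst (x ∈ˢ_) (≡.sym eq) x∈K))
    BorK : ∀ {X} → Differ (x ∷ s) (y ∷ t) X → X ≡ B ⊎ X ≡ K
    BorK = third {Q = Differ (x ∷ s) (y ∷ t)} only
      (inj₁ (L.lost B-tube y∈B)) (inj₂ (R.lost K-tube x∈K)) B≢K
    only-B : ∀ {X} → Tube s X → y ∈ˢ X → X ≡ B
    only-B q y∈X with BorK (inj₁ (L.lost q y∈X))
    ... | inj₁ eq = eq
    ... | inj₂ ≡.refl = contradiction (tube⊆ q x∈K) (head∉ us)
    only-K : ∀ {X} → Tube t X → x ∈ˢ X → X ≡ K
    only-K q x∈X with BorK (inj₂ (R.lost q x∈X))
    ... | inj₂ eq = eq
    ... | inj₁ ≡.refl = contradiction (tube⊆ q y∈B) (head∉ ut)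
    s-front = L.front λ q y∈ q′ y∈′ → ≡.trans (only-B q y∈) (≡.sym (only-B q′ y∈′))
    t-front = R.front λ q x∈ q′ x∈′ → ≡.trans (only-K q x∈) (≡.sym (only-K q′ x∈′))
    s′ = proj₁ s-front
    t′ = proj₁ t-front
    s≈ = proj₂ s-front
    t≈ = proj₂ t-front
    us″ : Unique (y ∷ s′)
    us″ = Unique-resp-↭ (≈⇒↭ s≈) us′
    ut″ : Unique (x ∷ t′)
    ut″ = Unique-resp-↭ (≈⇒↭ t≈) ut′
    s′↭t′ : s′ ↭ t′
    s′↭t′ = drop-∷ (drop-∷ (trans (↭-sym (trans (prep x (≈⇒↭ s≈)) (swap x y refl)))
      (trans p (prep y (≈⇒↭ t≈)))))
    y∉s′ = head∉ us″
    x∉s′ : x ∉ s′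
    x∉s′ x∈ = head∉ us (∈-resp-↭ (↭-sym (≈⇒↭ s≈)) (there x∈))
    transfer : ∀ {X} → Tube s′ X → Tube t′ X
    -- Only tubes that fail to survive are known to be `B` or `K`, so it has to be decided whether
    -- `X` survives.
    transfer {X} q with tube? (y ∷ t) X
    transfer {X} q | yes (here ≡.refl) =
      contradiction (tube⊆ q (∈-top y t)) y∉s′
    transfer {X} q | yes (there r) with ≈⇒tube t≈ r
    ... | here ≡.refl = contradiction (tube⊆ q (∈-top x t′)) x∉s′
    ... | there r′    = r′
    transfer {X} q | no nr with BorK (inj₁ (there (≈⇒tube (≈-sym s≈) (there q)) , nr))
    ... | inj₁ ≡.refl = contradiction (tube⊆ q y∈B) y∉s′
    ... | inj₂ ≡.refl = contradiction (tube⊆ q x∈K) x∉s′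
    path : Path 1 (x ∷ s) (y ∷ t)
    path = free (x ∷ s≈) (swap here (free (y ∷ x ∷
      sameTubes⇒≈ (AllPairs.tail us″) (AllPairs.tail ut″) s′↭t′ transfer)
      (free (y ∷ ≈-sym t≈) [])))

-- Translation between search trees and words, walks and paths

sameTubes-sym : ∀ {n} {T U : Tree n} → SameTubes T U → SameTubes U T
sameTubes-sym same X = proj₂ (same X) , proj₁ (same X)

rotation-respˡ : ∀ {n} {T T′ U : Tree n} → SameTubes T T′ → Rotation T′ U → Rotation T U
rotation-respˡ {T = T} {T′} {U} same (A , B , A≢B , dA , dB , only) =
  A , B , A≢B , move (sameTubes-sym same) dA , move (sameTubes-sym same) dB ,
  λ X d → only X (move same d)
  where
  move : ∀ {T T′ X} → SameTubes T T′ → InSymDiff T U X → InSymDiff T′ U X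
  move same (inj₁ (q , nq)) = inj₁ (proj₁ (same _) q , nq)
  move same (inj₂ (q , nq)) = inj₂ (q , λ r → nq (proj₂ (same _) r))

walk-respˡ : ∀ {n} {G : Graph n} {k T T′ U} → SameTubes T T′ → Walk G k T′ U → Walk G k T U
walk-respˡ same (done same′)   =
  done λ X → (λ q → proj₁ (same′ X) (proj₁ (same X) q)) , (λ q → proj₂ (same X) (proj₂ (same′ X) q))
walk-respˡ same (step sv r ws) = step sv (rotation-respˡ same r) ws

module TreeWalks {n : ℕ} {P : Fin n → Set} (P? : Decidable P) where

  open Words P?
  open Trees P?

  hub-connected : ∀ {S : Subset n} {c} → P c → c ∈ˢ S → Connected G S
  hub-connected {S} {c} pc c∈S = (c , c∈S) , reach
    where
    toHub : ∀ u → u ∈ˢ S → Reach G S u c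
    toHub u u∈S with u ≟ c
    ... | yes ≡.refl = here u∈S
    ... | no u≢c     = step u∈S (u≢c , inj₂ pc) (here c∈S)
    reach : ∀ u v → u ∈ˢ S → v ∈ˢ S → Reach G S u v
    reach u v u∈S v∈S with v ≟ c
    ... | yes ≡.refl = toHub u u∈S
    ... | no v≢c with u ≟ c
    ...   | yes ≡.refl = step u∈S ((λ eq → v≢c (≡.sym eq)) , inj₁ pc) (here v∈S)
    ...   | no u≢c     =
      step u∈S (u≢c , inj₂ pc) (step c∈S ((λ eq → v≢c (≡.sym eq)) , inj₁ pc) (here v∈S))

  leaf-search : ∀ v → IsSearchTree G (verts (leaf v)) (leaf v)
  leaf-search v = st (root∈verts v []) [] [] λ x x∈ x≢v → contradiction (∈-leaf v x∈) x≢v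

  leaf-component : ∀ {S : Subset n} {v} → (∀ {u} → u ∈ˢ S → ¬ P u) → v ∈ˢ S →
    IsComponent G S (verts (leaf v))
  leaf-component {S} {v} indep v∈S =
    (λ x∈ → subst (_∈ˢ S) (≡.sym (∈-leaf v x∈)) v∈S) ,
    ((v , root∈verts v []) , λ x y x∈ y∈ → reach (∈-leaf v x∈) (∈-leaf v y∈)) ,
    λ x y x∈ y∈S adj → contradiction adj (no-edge (∈-leaf v x∈) y∈S)
    where
    reach : ∀ {x y} → x ≡ v → y ≡ v → Reach G (verts (leaf v)) x y
    reach ≡.refl ≡.refl = here (root∈verts v [])
    no-edge : ∀ {x y} → x ≡ v → y ∈ˢ S → ¬ Adj G x y
    no-edge ≡.refl y∈ (_ , inj₁ px) = indep v∈S px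
    no-edge ≡.refl y∈ (_ , inj₂ py) = indep y∈ py

  ∈-without : ∀ {S : Subset n} {v t} → Unique (v ∷ t) →
    (∀ {x} → x ∈ˢ S ⇔ x ∈ v ∷ t) → ∀ {x} → x ∈ˢ S - v ⇔ x ∈ t
  ∈-without {S} uniq set = mk⇔
    (λ x∈ → ∈-tail (x∈p-y⇒x≢y S x∈) (to set (p─q⊆p S _ x∈)))
    (λ x∈ → x∈p∧x≢y⇒x∈p-y (from set (there x∈)) λ { ≡.refl → head∉ uniq x∈ })

  word-search : ∀ {S : Subset n} v t → Unique (v ∷ t) → Any P (v ∷ t) →
    (∀ {x} → x ∈ˢ S ⇔ x ∈ v ∷ t) → IsSearchTree G S (node v (forest t))
  word-search {S} v t uniq p set with hasP? t
  ... | no np rewrite forest-¬P np = st (from set (here ≡.refl))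
    (AllP.map⁺ (All.tabulate λ x∈ →
      leaf-component (λ u∈ pu → np (lose (to rest u∈) pu)) (from rest x∈) , leaf-search _))
    (AllPairsP.map⁺ (AllPairs.map (λ x≢y u u∈x u∈y →
      x≢y (≡.trans (≡.sym (∈-leaf _ u∈x)) (∈-leaf _ u∈y))) (AllPairs.tail uniq)))
    (λ x x∈S x≢v → AnyP.map⁺ (Any.map (λ { ≡.refl → root∈verts x [] })
      (∈-tail x≢v (to set x∈S))))
    where
    rest : ∀ {x} → x ∈ˢ S - v ⇔ x ∈ t
    rest = ∈-without uniq set
  word-search {S} v t@(w ∷ t′) uniq p set | yes pt rewrite forest-P pt =
    let c , c∈t , pc = find pt in
    st (from set (here ≡.refl))
      ((((λ x∈ → from rest (∈-node⁻ w t′ x∈)) ,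
        hub-connected pc (∈-node⁺ w t′ c∈t) ,
        (λ x y x∈ y∈ adj → ∈-node⁺ w t′ (to rest y∈))) ,
        word-search w t′ (AllPairs.tail uniq) pt (mk⇔ (∈-node⁻ w t′) (∈-node⁺ w t′))) ∷ [])
      ([] ∷ [])
      (λ x x∈S x≢v → here (∈-node⁺ w t′ (∈-tail x≢v (to set x∈S))))
    where
    rest : ∀ {x} → x ∈ˢ S - v ⇔ x ∈ t
    rest = ∈-without uniq set

  -- A child would contain a vertex `u` other than the root `v`. Connectedness of `K` joins them by
  -- a path, whose first edge has an end in P.
  component-leaf : ∀ {S K : Subset n} {T} → (∀ {u} → u ∈ˢ S → ¬ P u) → IsComponent G S K →
    IsSearchTree G K T → ∃ λ v → T ≡ leaf v × v ∈ˢ S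
  component-leaf indep (K⊆S , _) (st {ts = []} v∈K _ _ _) = _ , ≡.refl , K⊆S v∈K
  component-leaf {S} {K} indep (K⊆S , (_ , reach) , _)
    (st {r = v} v∈K (((D⊆ , ((u , u∈D) , _) , _) , _) ∷ _) _ _) =
    contradiction (reach u v (p─q⊆p K _ (D⊆ u∈D)) v∈K) no-reach
    where
    start : ∀ {x y} → Reach G K x y → x ∈ˢ K
    start (here x∈)     = x∈
    start (step x∈ _ _) = x∈
    no-reach : ¬ Reach G K u v
    no-reach (here _)                    = x∈p-y⇒x≢y K (D⊆ u∈D) ≡.refl
    no-reach (step u∈ (_ , inj₁ pu) _)   = indep (K⊆S u∈) pu
    no-reach (step u∈ (_ , inj₂ pw) rch) = indep (K⊆S (start rch)) pw

  components-leaves : ∀ {S : Subset n} {ts} → (∀ {u} → u ∈ˢ S → ¬ P u) →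
    All (λ c → IsComponent G S (verts c) × IsSearchTree G (verts c) c) ts →
    ∃ λ vs → ts ≡ map (λ v → leaf v) vs × All (_∈ˢ S) vs
  components-leaves indep []                   = [] , ≡.refl , []
  components-leaves indep ((comp , tree) ∷ cs) =
    let v , eq , v∈S    = component-leaf indep comp tree
        vs , eqs , vs∈S = components-leaves indep cs
    in v ∷ vs , cong₂ _∷_ eq eqs , v∈S ∷ vs∈S

  hub∈component : ∀ {S K : Subset n} {c} → P c → c ∈ˢ S → IsComponent G S K → c ∈ˢ K
  hub∈component {c = c} pc c∈S (_ , ((u , u∈K) , _) , closed) with u ≟ c
  ... | yes ≡.refl = u∈K
  ... | no u≢c     = closed u c u∈K c∈S (u≢c , inj₂ pc)

  Spelled : Subset n → Tree n → Set
  Spelled S T = ∃ λ v → ∃ λ t → T ≡ node v (forest t) × Unique (v ∷ t) × (∀ {x} → x ∈ˢ S ⇔ x ∈ v ∷ t)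

  spell : ∀ {S : Subset n} {T} → IsSearchTree G S T → ∃ (λ c → c ∈ˢ S × P c) → Spelled S T
  spell {S} (st {r = r} {ts} r∈S children disjoint cover) _
    with anyFin? (λ x → x ∈ˢ? (S - r) ×-dec P? x)
  spell {S} (st {r = r} {ts} r∈S children disjoint cover) _ | no none
    with components-leaves (λ {u} u∈ pu → none (u , u∈ , pu)) children
  ... | vs , ≡.refl , vs∈S =
    r , vs ,
    cong (node r) (≡.sym (forest-¬P (All¬⇒¬Any (All.map (λ v∈ pv → none (_ , v∈ , pv)) vs∈S)))) ,
    All.map (λ v∈ eq → x∈p-y⇒x≢y S v∈ (≡.sym eq)) vs∈S ∷
      AllPairs.map (λ {x} dis → λ { ≡.refl → dis x (root∈verts x []) (root∈verts x []) })
        (AllPairsP.map⁻ disjoint) ,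
    mk⇔ to′ from′
    where
    to′ : ∀ {x} → x ∈ˢ S → x ∈ r ∷ vs
    to′ {x} x∈S with x ≟ r
    ... | yes eq = here eq
    ... | no x≢r = there (Any.map (∈-leaf _) (AnyP.map⁻ (cover x x∈S x≢r)))
    from′ : ∀ {x} → x ∈ r ∷ vs → x ∈ˢ S
    from′ (here ≡.refl) = r∈S
    from′ (there x∈)    = p─q⊆p S _ (All.lookup vs∈S x∈)
  spell {S} (st {ts = []} r∈S [] disjoint cover) _ | yes (c , c∈ , pc)
    with () ← cover c (p─q⊆p S _ c∈) (x∈p-y⇒x≢y S c∈)
  -- Being adjacent to everything, `c` lies in every component, so two disjoint children are
  -- impossible.
  spell {S} (st {ts = d ∷ e ∷ _} r∈S ((cd , _) ∷ (ce , _) ∷ _) ((d#e ∷ _) ∷ _) cover) _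
    | yes (c , c∈ , pc) = contradiction (hub∈component pc c∈ ce) (d#e c (hub∈component pc c∈ cd))
  spell {S} (st {r = r} {ts = d ∷ []} r∈S ((comp , tree) ∷ []) disjoint cover) _
    | yes (c , c∈ , pc) with spell tree (c , hub∈component pc c∈ comp , pc)
  ... | v , t , ≡.refl , uniq , set =
    r , v ∷ t , cong (node r) (≡.sym (forest-P (lose (to set (hub∈component pc c∈ comp)) pc))) ,
    All.tabulate (λ x∈ eq → x∈p-y⇒x≢y S (proj₁ comp (from set x∈)) (≡.sym eq)) ∷ uniq ,
    mk⇔ to′ from′
    where
    to′ : ∀ {x} → x ∈ˢ S → x ∈ r ∷ v ∷ t
    to′ {x} x∈S with x ≟ r
    ... | yes eq = here eq
    ... | no x≢r with here x∈d ← cover x x∈S x≢r = there (to set x∈d)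
    from′ : ∀ {x} → x ∈ r ∷ v ∷ t → x ∈ˢ S
    from′ (here ≡.refl) = r∈S
    from′ (there x∈)    = p─q⊆p S _ (proj₁ comp (from set x∈))

  -- The field `hasP` ensures that the first letter is a root above all others; without it `forest`
  -- would yield separate leaves.
  record Word (w : List (Fin n)) : Set where
    field
      unique   : Unique w
      complete : ∀ x → x ∈ w
      hasP     : Any P w
  open Word

  word-↭ : ∀ {s t} → s ↭ t → Word s → Word t
  word-↭ p ws = record
    { unique   = Unique-resp-↭ p (unique ws)
    ; complete = λ x → ∈-resp-↭ p (complete ws x)
    ; hasP     = Any-resp-↭ p (hasP ws) }

  search-represented : ∀ {c T} → P c → SearchTree G T → ∃ λ w → Word w × Represents w T
  search-represented pc tree with spell tree (_ , ∈⊤ , pc)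
  ... | v , t , ≡.refl , uniq , set = v ∷ t ,
    record { unique = uniq ; complete = λ x → to set ∈⊤ ; hasP = lose (to set ∈⊤) pc } , rep

  represented-search : ∀ {w T} → Word w → Represents w T → SearchTree G T
  represented-search ws (rep {v} {t}) =
    word-search v t (unique ws) (hasP ws) (mk⇔ (λ _ → complete ws _) (λ _ → ∈⊤))

  represent : ∀ {w} → Word w → ∃ (Represents w)
  represent {_ ∷ _} ws = _ , rep
  represent {[]}    ws with () ← hasP ws

  module _ {s t T U} (ws : Word s) (wt : Word t) (sT : Represents s T) (tU : Represents t U) where

    private
      module S {X} = Equivalence (tubes⇔ {X = X} (hasP ws) sT)
      module T {X} = Equivalence (tubes⇔ {X = X} (hasP wt) tU)

    differ⁺ : ∀ {X} → Differ s t X → InSymDiff T U X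
    differ⁺ (inj₁ (q , nq)) = inj₁ (S.from q , λ r → nq (T.to r))
    differ⁺ (inj₂ (q , nq)) = inj₂ (T.from q , λ r → nq (S.to r))

    differ⁻ : ∀ {X} → InSymDiff T U X → Differ s t X
    differ⁻ (inj₁ (q , nq)) = inj₁ (S.to q , λ r → nq (T.from r))
    differ⁻ (inj₂ (q , nq)) = inj₂ (T.to q , λ r → nq (S.from r))

    rotation⁺ : Rotates s t → Rotation T U
    rotation⁺ (A , B , A≢B , dA , dB , only) =
      A , B , A≢B , differ⁺ dA , differ⁺ dB , λ X d → only X (differ⁻ d)

    rotation⁻ : Rotation T U → Rotates s t
    rotation⁻ (A , B , A≢B , dA , dB , only) =
      A , B , A≢B , differ⁻ dA , differ⁻ dB , λ X d → only X (differ⁺ d)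

    sameTubes⁺ : s ≈ t → SameTubes T U
    sameTubes⁺ p X = (λ q → T.from (≈⇒tube p (S.to q))) , (λ q → S.from (≈⇒tube (≈-sym p) (T.to q)))

    sameTubes⁻ : s ↭ t → SameTubes T U → s ≈ t
    sameTubes⁻ p same = sameTubes⇒≈ (unique ws) (unique wt) p λ q → T.to (proj₁ (same _) (S.from q))

  -- The walk may be shorter than the path, because a swap of two leaves is no rotation.
  path⇒walk : ∀ {k s t T U} → Path k s t → Word s → Represents s T → Represents t U →
    ∃ λ j → j ≤ k × Walk G j T U
  path⇒walk [] ws rep rep = 0 , z≤n , done λ X → (λ q → q) , (λ q → q)
  path⇒walk (free p ps) ws sT tU =
    let wv = word-↭ (≈⇒↭ p) ws ; V , vV = represent wv
        j , j≤k , walk = path⇒walk ps wv vV tU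
    in j , j≤k , walk-respˡ (sameTubes⁺ ws wv sT vV p) walk
  path⇒walk (swap p ps) ws sT tU =
    let wv = word-↭ (⇄⇒↭ p) ws ; V , vV = represent wv
        j , j≤k , walk = path⇒walk ps wv vV tU
    in case ⇄⇒rotates p (unique ws) of λ
      { (inj₁ q) → j , m≤n⇒m≤1+n j≤k , walk-respˡ (sameTubes⁺ ws wv sT vV q) walk
      ; (inj₂ r) → suc j , s≤s j≤k ,
          step (represented-search wv vV) (rotation⁺ ws wv sT vV r) walk }

  path-trans : ∀ {k l s t u} → Path k s t → Path l t u → Path (k + l) s u
  path-trans []          qs = qs
  path-trans (free p ps) qs = free p (path-trans ps qs)
  path-trans (swap p ps) qs = swap p (path-trans ps qs)

  words-↭ : ∀ {s t} → Word s → Word t → s ↭ t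
  words-↭ ws wt =
    sameElements⇒↭ (unique ws) (unique wt) (λ {x} _ → complete wt x) (λ {x} _ → complete ws x)

  walk⇒path : ∀ {k s t T U} → Walk G k T U → Word s → Word t → Represents s T → Represents t U →
    Path k s t
  walk⇒path (done same) ws wt sT tU =
    free (sameTubes⁻ ws wt sT tU (words-↭ ws wt) same) []
  walk⇒path (step sv r walk) ws wt sT tU with search-represented (proj₂ (proj₂ (find (hasP ws)))) sv
  ... | v , wv , vV = path-trans
    (rotates⇒path (unique ws) (unique wv) (words-↭ ws wv) (rotation⁻ ws wv sT vV r))
    (walk⇒path walk wv wt vV tU)

-- Arithmetic of the balance between depths and pairs

C2-double : ∀ n → 2 * (n C 2) + n ≡ n * n
C2-double zero    = ≡.refl
C2-double (suc n) = begin
  2 * (suc n C 2) + suc n       ≡⟨ cong (λ c → 2 * c + suc n) (C2-suc n) ⟩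
  2 * (n + n C 2) + suc n       ≡⟨ solve 2 (λ n c → con 2 :* (n :+ c) :+ (con 1 :+ n)
                                     := con 2 :* c :+ n :+ (con 1 :+ con 2 :* n)) ≡.refl n (n C 2) ⟩
  2 * (n C 2) + n + (1 + 2 * n) ≡⟨ cong (_+ (1 + 2 * n)) (C2-double n) ⟩
  n * n + (1 + 2 * n)           ≡⟨ solve 1 (λ n → n :* n :+ (con 1 :+ con 2 :* n)
                                     := (con 1 :+ n) :* (con 1 :+ n)) ≡.refl n ⟩
  suc n * suc n                 ∎
  where
  open ≡.≡-Reasoning
  open +-*-Solver

C2-+ : ∀ m n → (m + n) C 2 ≡ m C 2 + n C 2 + m * n
C2-+ zero    n = ≡.sym (+-identityʳ (n C 2))
C2-+ (suc m) n = begin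
  suc (m + n) C 2                     ≡⟨ C2-suc (m + n) ⟩
  m + n + (m + n) C 2                 ≡⟨ cong (m + n +_) (C2-+ m n) ⟩
  m + n + (m C 2 + n C 2 + m * n)     ≡⟨ solve 4 (λ m n c d → m :+ n :+ (c :+ d :+ m :* n)
                                           := m :+ c :+ d :+ (n :+ m :* n)) ≡.refl
                                           m n (m C 2) (n C 2) ⟩
  m + m C 2 + n C 2 + (n + m * n)     ≡⟨ cong (λ c → c + n C 2 + (n + m * n)) (C2-suc m) ⟨
  suc m C 2 + n C 2 + suc m * n       ∎
  where
  open ≡.≡-Reasoning
  open +-*-Solver

-- If both were larger, their sum would be at least 2d + 2 + 2(x / 2), which exceeds 2d + x. The
-- floor in the upper bound arises here, with the lengths of the two strategies as `k` and `l`.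
average : ∀ {k l d x} → k + l ≤ 2 * d + x → k ≤ d + x / 2 ⊎ l ≤ d + x / 2
average {k} {l} {d} {x} sum≤ with k ≤? d + x / 2 | l ≤? d + x / 2
... | yes p | _     = inj₁ p
... | no _  | yes p = inj₂ p
... | no k≰ | no l≰ = contradiction (begin-strict
  k + l                               ≤⟨ sum≤ ⟩
  2 * d + x                           ≡⟨ cong (2 * d +_) (m≡m%n+[m/n]*n x 2) ⟩
  2 * d + (x % 2 + x / 2 * 2)         <⟨ +-monoʳ-< (2 * d) (+-monoˡ-< (x / 2 * 2) (m%n<n x 2)) ⟩
  2 * d + (2 + x / 2 * 2)             ≡⟨ solve 2 (λ d h → con 2 :* d :+ (con 2 :+ h :* con 2)
                                           := con 1 :+ (d :+ h) :+ (con 1 :+ (d :+ h))) ≡.refl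
                                           d (x / 2) ⟩
  suc (d + x / 2) + suc (d + x / 2)   ≤⟨ +-mono-≤ (≰⇒> k≰) (≰⇒> l≰) ⟩
  k + l                               ∎) (<-irrefl ≡.refl)
  where
  open ≤-Reasoning
  open +-*-Solver

-- If q elements carry the weights f and f + 1, where q = 1 + 4f + g, then any t
-- of them, l of which are heavy, carry at most half of the pairs that they meet.
light : ∀ {s t l f g} → s + t ≡ 1 + 4 * f + g → 4 * l ≤ t * (g + s) →
  s C 2 + 2 * (f * t + l) ≤ (s + t) C 2
light {s} {t} {l} {f} {g} q≡ 4l≤ = *-cancelˡ-≤ 2 (+-cancelʳ-≤ (s + t) _ _ (begin
  2 * (s C 2 + 2 * (f * t + l)) + (s + t)
    ≡⟨ solve 5 (λ c f t l s → con 2 :* (c :+ con 2 :* (f :* t :+ l)) :+ (s :+ t)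
         := con 2 :* c :+ s :+ (t :+ con 4 :* f :* t) :+ con 4 :* l) ≡.refl (s C 2) f t l s ⟩
  2 * (s C 2) + s + (t + 4 * f * t) + 4 * l
    ≤⟨ +-mono-≤ (≤-reflexive (cong (_+ (t + 4 * f * t)) (C2-double s))) 4l≤ ⟩
  s * s + (t + 4 * f * t) + t * (g + s)
    ≡⟨ solve 4 (λ s t f g → s :* s :+ (t :+ con 4 :* f :* t) :+ t :* (g :+ s)
         := s :* s :+ t :* s :+ t :* (con 1 :+ con 4 :* f :+ g)) ≡.refl s t f g ⟩
  s * s + t * s + t * (1 + 4 * f + g)
    ≡⟨ cong (λ m → s * s + t * s + t * m) q≡ ⟨
  s * s + t * s + t * (s + t)
    ≡⟨ solve 2 (λ s t → s :* s :+ t :* s :+ t :* (s :+ t) := (s :+ t) :* (s :+ t)) ≡.refl s t ⟩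
  (s + t) * (s + t)
    ≡⟨ C2-double (s + t) ⟨
  2 * ((s + t) C 2) + (s + t) ∎))
  where
  open ≤-Reasoning
  open +-*-Solver

-- There are `r` heavy elements in all, `l` of them among the `t` chosen ones. For g ≤ t the bound
-- on `r` suffices. For g > t ≥ 1 both `g` and `s` are at least 2, so l ≤ t suffices.
heavy : ∀ {s t l f g r} → s + t ≡ 1 + 4 * f + g → l ≤ t → l ≤ r → 4 * r ≤ g * (s + t) →
  4 * l ≤ t * (g + s)
heavy {t = zero} q≡ z≤n l≤r 4r≤ = z≤n
heavy {s} {t@(suc t′)} {l} {f} {g} {r} q≡ l≤t l≤r 4r≤ with g ≤? t
... | yes g≤t = begin
  4 * l         ≤⟨ *-monoʳ-≤ 4 l≤r ⟩
  4 * r         ≤⟨ 4r≤ ⟩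
  g * (s + t)   ≡⟨ *-distribˡ-+ g s t ⟩
  g * s + g * t ≤⟨ +-monoˡ-≤ (g * t) (*-monoˡ-≤ s g≤t) ⟩
  t * s + g * t ≡⟨ solve 3 (λ s t g → t :* s :+ g :* t := t :* (g :+ s)) ≡.refl s t g ⟩
  t * (g + s)   ∎
  where
  open ≤-Reasoning
  open +-*-Solver
... | no g≰t = begin
  4 * l       ≤⟨ *-monoʳ-≤ 4 l≤t ⟩
  4 * t       ≤⟨ *-monoˡ-≤ t (+-mono-≤ (≤-trans (s≤s (s≤s z≤n)) t<g) s≥2) ⟩
  (g + s) * t ≡⟨ *-comm (g + s) t ⟩
  t * (g + s) ∎
  where
  open ≤-Reasoning
  t<g : t < g
  t<g = ≰⇒> g≰t
  s≥2 : 2 ≤ s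
  s≥2 = +-cancelʳ-≤ t 2 s (begin
    2 + t           ≤⟨ s≤s t<g ⟩
    1 + g           ≤⟨ +-monoˡ-≤ g (m≤m+n 1 (4 * f)) ⟩
    1 + 4 * f + g   ≡⟨ q≡ ⟨
    s + t           ∎)

below : ℕ → ℕ → ℕ
below m n = if n <ᵇ m then 1 else 0

below-< : ∀ {m n} → n < m → below m n ≡ 1
below-< {m} {n} p rewrite dec-true (n <? m) p = ≡.refl

below-≥ : ∀ {m n} → m ≤ n → below m n ≡ 0
below-≥ {m} {n} p rewrite dec-false (n <? m) (≤⇒≯ p) = ≡.refl

below≤1 : ∀ m n → below m n ≤ 1
below≤1 m n with n <ᵇ m
... | true  = ≤-refl
... | false = z≤n

-- The offset `a` covers both P, whose indices start at 0, and Q, whose indices start at `p`.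
count-below : ∀ a {c m} → c ≤ m → sum (tabulate {n = m} (λ i → below (a + c) (a + toℕ i))) ≡ c
count-below (suc a) c≤m                       = count-below a c≤m
count-below zero {zero}  {zero}  c≤m          = ≡.refl
count-below zero {zero}  {suc m} c≤m          = count-below zero {zero} {m} z≤n
count-below zero {suc c} {suc m} (s≤s c≤m)    = cong suc (count-below zero c≤m)

-- Words of the complete split graph and the upper bound

module SplitGraph (p q : ℕ) (0<p : 1 ≤ p) where

  -- For this `P` the graph `G` of the modules above is `SPK p q` by definition, so their results
  -- apply without transport.
  P : Fin (p + q) → Set
  P = InP p

  P? : Decidable P
  P? v = toℕ v <? p

  open Words P?
  open Trees P? using (Represents)
  open TreeWalks P?

  -- The word `base` is the reference in which pairs are counted by type, and also the start of the
  -- extremal path.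
  ps qs base : List (Fin (p + q))
  ps   = tabulate (_↑ˡ q)
  qs   = tabulate (p ↑ʳ_)
  base = qs ++ ps

  all-ps : All P ps
  all-ps = AllP.tabulate⁺ λ i → subst (_< p) (≡.sym (toℕ-↑ˡ i q)) (toℕ<n i)

  all-qs : All (λ v → p ≤ toℕ v) qs
  all-qs = AllP.tabulate⁺ λ i → subst (p ≤_) (≡.sym (toℕ-↑ʳ p i)) (m≤m+n p (toℕ i))

  all-¬ps : All (λ v → ¬ P v) qs
  all-¬ps = All.map ≤⇒≯ all-qs

  length-ps : length ps ≡ p
  length-ps = length-tabulate (_↑ˡ q)

  length-qs : length qs ≡ q
  length-qs = length-tabulate (p ↑ʳ_)

  increasing-ps : AllPairs (λ v u → toℕ v < toℕ u) ps
  increasing-ps = AllPairsP.tabulate⁺-< λ {i} {j} i<j →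
    ≡.subst₂ _<_ (≡.sym (toℕ-↑ˡ i q)) (≡.sym (toℕ-↑ˡ j q)) i<j

  increasing-qs : AllPairs (λ v u → toℕ v < toℕ u) qs
  increasing-qs = AllPairsP.tabulate⁺-< λ {i} {j} i<j →
    ≡.subst₂ _<_ (≡.sym (toℕ-↑ʳ p i)) (≡.sym (toℕ-↑ʳ p j)) (+-monoʳ-< p i<j)

  base-word : Word base
  base-word = record
    { unique   = UniqueP.++⁺ (UniqueP.tabulate⁺ (↑ʳ-injective p _ _))
        (UniqueP.tabulate⁺ (↑ˡ-injective q _ _))
        λ (v∈qs , v∈ps) → All.lookup all-¬ps v∈qs (All.lookup all-ps v∈ps)
    ; complete = complete
    ; hasP     = some-P 0<p }
    where
    complete : ∀ v → v ∈ base
    complete v with Fin.splitAt p v in eq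
    ... | inj₁ i = ∈-++⁺ʳ qs (subst (_∈ ps) (splitAt⁻¹-↑ˡ eq) (∈-tabulate⁺ i))
    ... | inj₂ j = ∈-++⁺ˡ (subst (_∈ qs) (splitAt⁻¹-↑ʳ eq) (∈-tabulate⁺ j))
    some-P : 1 ≤ p → Any P base
    some-P 1≤p = lose (complete (Fin.fromℕ< 1≤p ↑ˡ q))
      (All.lookup all-ps (∈-tabulate⁺ (Fin.fromℕ< 1≤p)))

  some : ∃ P
  some = let v , _ , pv = find (Word.hasP base-word) in v , pv

  word-↭-base : ∀ {w} → Word w → w ↭ base
  word-↭-base ws = words-↭ ws base-word

  pairs-mixed : ∀ {w} → Word w → pairSum mixed w ≡ p * q
  pairs-mixed {w} ws = begin
    pairSum mixed w
      ≡⟨ pairSum-↭ mixed mixed-sym (word-↭-base ws) ⟩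
    pairSum mixed base
      ≡⟨ pairSum-++ mixed qs ps ⟩
    pairSum mixed qs + sumBy (λ v → sumBy (mixed v) ps) qs + pairSum mixed ps
      ≡⟨ cong₂ _+_ (cong₂ _+_ (pairSum≡const (allPairs (λ v → ¬ P v) mixed-QQ all-¬ps))
           (sumBy≡const (All.map (λ qv → sumBy≡const (All.map (mixed-QP qv) all-ps)) all-¬ps)))
           (pairSum≡const (allPairs P mixed-PP all-ps)) ⟩
    (length qs C 2) * 0 + length qs * (length ps * 1) + (length ps C 2) * 0
      ≡⟨ cong₂ (λ a b → (a C 2) * 0 + a * (b * 1) + (b C 2) * 0) length-qs length-ps ⟩
    (q C 2) * 0 + q * (p * 1) + (p C 2) * 0
      ≡⟨ solve 4 (λ c d p q → d :* con 0 :+ q :* (p :* con 1) :+ c :* con 0 := p :* q) ≡.refl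
           (p C 2) (q C 2) p q ⟩
    p * q ∎
    where
    open ≡.≡-Reasoning
    open +-*-Solver
    allPairs : ∀ (R : Fin (p + q) → Set) → (∀ {v u} → R v → R u → mixed v u ≡ 0) →
      ∀ {w} → All R w → AllPairs (λ v u → mixed v u ≡ 0) w
    allPairs R f []       = []
    allPairs R f (r ∷ rs) = All.map (f r) rs ∷ allPairs R f rs

  length-base : length base ≡ p + q
  length-base = ≡.trans (length-++ qs) (≡.trans (cong₂ _+_ length-qs length-ps) (+-comm q p))

  pairs-budget : ∀ {w} → Word w → pairSum budget w ≡ (p + q) C 2 + p * q
  pairs-budget {w} ws = begin
    pairSum budget w                      ≡⟨ pairSum-+ (λ _ _ → 1) mixed w ⟩
    pairSum (λ _ _ → 1) w + pairSum mixed w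
      ≡⟨ cong₂ _+_ (pairSum-const 1 w) (pairs-mixed ws) ⟩
    (length w C 2) * 1 + p * q
      ≡⟨ cong (_+ p * q) (≡.trans (*-identityʳ _)
           (cong (_C 2) (≡.trans (↭-length (word-↭-base ws)) length-base))) ⟩
    (p + q) C 2 + p * q                   ∎
    where open ≡.≡-Reasoning

  length-filter-P : ∀ {w} → Word w → length (filter P? w) ≡ p
  length-filter-P {w} ws = begin
    length (filter P? w)                  ≡⟨ ↭-length (filter-↭ P? (word-↭-base ws)) ⟩
    length (filter P? base)               ≡⟨ cong length (filter-++ P? qs ps) ⟩
    length (filter P? qs ++ filter P? ps)
      ≡⟨ cong₂ (λ a b → length (a ++ b)) (filter-none P? all-¬ps) (filter-all P? all-ps) ⟩
    length ps                             ≡⟨ length-ps ⟩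
    p                                     ∎
    where open ≡.≡-Reasoning

  sinks≤ : ∀ {w} → Word w → pairSum sink w ≤ p * q
  sinks≤ {w} ws = ≤-trans (pairSum-mono (universal₂ w)) (≤-reflexive (pairs-mixed ws))
    where
    universal₂ : ∀ w → AllPairs (λ v u → sink v u ≤ mixed v u) w
    universal₂ []      = []
    universal₂ (v ∷ w) = All.universal (sink≤mixed v) w ∷ universal₂ w

  -- Here `k` and `l` are the lengths of the sorting and the sinking path, and `a` and `b` the
  -- sinking costs of the two words. The choice between them is left as a numerical hypothesis
  -- because it differs in the two ranges of q.
  upper : ∀ {d} →
    (∀ {k l a b} → a ≤ p * q → b ≤ p * q → k + (a + b) ≤ (p + q) C 2 + p * q →
      l ≤ a + b + p C 2 → k ≤ d ⊎ l ≤ d) →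
    ∀ T U → SearchTree (SPK p q) T → SearchTree (SPK p q) U →
    ∃ λ k → k ≤ d × Walk (SPK p q) k T U
  upper {d} choose T U sT sU =
    let _ , pv = some
        t , wt , tT = search-represented pv sT
        u , wu , uU = search-represented pv sU
        k , pathᵏ , k≤ = direct-path (words-↭ wt wu)
        l , pathˡ , l≤ = sinking-path (words-↭ wt wu)
        conclude : ∀ {k} → Path k t u → k ≤ d → ∃ λ j → j ≤ d × Walk (SPK p q) j T U
        conclude path k≤d =
          let j , j≤k , walk = path⇒walk path wt tT uU in j , ≤-trans j≤k k≤d , walk
    in [ conclude pathᵏ , conclude pathˡ ]′ (choose (sinks≤ wt) (sinks≤ wu)
         (≤-trans k≤ (≤-reflexive (pairs-budget wu)))
         (≤-trans l≤ (≤-reflexive 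
           (cong (λ m → pairSum sink t + pairSum sink u + m C 2) (length-filter-P wu)))))

  -- The lower bound: two words at maximal distance

  sumBy-tabulate : ∀ {m} (f : Fin (p + q) → ℕ) (g : Fin m → Fin (p + q)) →
    sumBy f (tabulate g) ≡ sum (tabulate (λ i → f (g i)))
  sumBy-tabulate f g = cong sum (map-tabulate g f)

  count-ps : ∀ {c} → c ≤ p → sumBy (λ v → below c (toℕ v)) ps ≡ c
  count-ps {c} c≤p = begin
    sumBy (λ v → below c (toℕ v)) ps
      ≡⟨ sumBy-tabulate (λ v → below c (toℕ v)) (_↑ˡ q) ⟩
    sum (tabulate {n = p} (λ i → below c (toℕ (i ↑ˡ q))))
      ≡⟨ cong sum (tabulate-cong {n = p} (λ i → cong (below c) (toℕ-↑ˡ i q))) ⟩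
    sum (tabulate {n = p} (λ i → below c (toℕ i)))
      ≡⟨ count-below 0 c≤p ⟩
    c ∎
    where open ≡.≡-Reasoning

  count-qs : ∀ {c} → c ≤ q → sumBy (λ v → below (p + c) (toℕ v)) qs ≡ c
  count-qs {c} c≤q = begin
    sumBy (λ v → below (p + c) (toℕ v)) qs
      ≡⟨ sumBy-tabulate (λ v → below (p + c) (toℕ v)) (p ↑ʳ_) ⟩
    sum (tabulate {n = q} (λ i → below (p + c) (toℕ (p ↑ʳ i))))
      ≡⟨ cong sum (tabulate-cong {n = q} (λ i → cong (below (p + c)) (toℕ-↑ʳ p i))) ⟩
    sum (tabulate {n = q} (λ i → below (p + c) (p + toℕ i)))
      ≡⟨ count-below p c≤q ⟩
    c ∎
    where open ≡.≡-Reasoning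

  -- The path leads from Q followed by P to the word that reverses both orders and
  -- has f vertices of P below each vertex of Q, and f + 1 below the last r ones.
  module Extremal (0<q : 1 ≤ q) (f r : ℕ) (f≤p : f ≤ p) (r≤q : r ≤ q) (f<p : 0 < r → f < p)
    (balanced : 4 * (f * q + r) + q ≤ q * q) where

    bump depth : ℕ → ℕ
    bump i  = if i <ᵇ p + (q ∸ r) then 0 else 1
    depth i = f + bump i

    bump-below : ∀ i → bump i + below (p + (q ∸ r)) i ≡ 1
    bump-below i with i <ᵇ p + (q ∸ r)
    ... | true  = ≡.refl
    ... | false = ≡.refl

    bump≤1 : ∀ i → bump i ≤ 1
    bump≤1 i = ≤-trans (m≤m+n (bump i) _) (≤-reflexive (bump-below i))

    -- This is why the deeper vertices are those of largest index: heights then increase along Q,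
    -- and the target inverts all pairs of Q.
    bump-mono : ∀ {i j} → i ≤ j → bump i ≤ bump j
    bump-mono {i} {j} i≤j with j <? p + (q ∸ r)
    ... | yes j< rewrite dec-true (j <? p + (q ∸ r)) j<
                       | dec-true (i <? p + (q ∸ r)) (≤-<-trans i≤j j<) = z≤n
    ... | no j≮ rewrite dec-false (j <? p + (q ∸ r)) j≮ = bump≤1 i

    depth≤p : ∀ (v : Fin (p + q)) → depth (toℕ v) ≤ p
    depth≤p v with toℕ v <? p + (q ∸ r)
    ... | yes v< rewrite dec-true (toℕ v <? p + (q ∸ r)) v< =
      ≤-trans (≤-reflexive (+-identityʳ f)) f≤p
    ... | no v≮ rewrite dec-false (toℕ v <? p + (q ∸ r)) v≮ =
      ≤-trans (≤-reflexive (+-comm f 1)) (f<p (n≢0⇒n>0 λ r≡0 →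
        v≮ (subst (λ m → toℕ v < p + (q ∸ m)) (≡.sym r≡0) (toℕ<n v))))

    sumBy-bump : sumBy (λ v → bump (toℕ v)) qs ≡ r
    sumBy-bump = +-cancelʳ-≡ (q ∸ r) _ _ (begin
      sumBy (λ v → bump (toℕ v)) qs + (q ∸ r)
        ≡⟨ cong (sumBy (λ v → bump (toℕ v)) qs +_) (count-qs (m∸n≤m q r)) ⟨
      sumBy (λ v → bump (toℕ v)) qs + sumBy (λ v → below (p + (q ∸ r)) (toℕ v)) qs
        ≡⟨ sumBy-+ (λ v → bump (toℕ v)) (λ v → below (p + (q ∸ r)) (toℕ v)) qs ⟨
      sumBy (λ v → bump (toℕ v) + below (p + (q ∸ r)) (toℕ v)) qs
        ≡⟨ sumBy≡const (All.universal (λ v → bump-below (toℕ v)) qs) ⟩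
      length qs * 1
        ≡⟨ *-identityʳ _ ⟩
      length qs
        ≡⟨ length-qs ⟩
      q
        ≡⟨ m+[n∸m]≡n r≤q ⟨
      r + (q ∸ r) ∎)
      where open ≡.≡-Reasoning

    -- Position in the target, counted from below: scaling by p + q leaves room for
    -- all of Q between consecutive vertices of P.
    height : Fin (p + q) → ℕ
    height v = if does (P? v) then suc (toℕ v) * (p + q) else depth (toℕ v) * (p + q) + toℕ v

    height-P : ∀ {v} → P v → height v ≡ suc (toℕ v) * (p + q)
    height-P {v} pv rewrite dec-true (P? v) pv = ≡.refl

    height-Q : ∀ {v} → p ≤ toℕ v → height v ≡ depth (toℕ v) * (p + q) + toℕ v
    height-Q {v} p≤v rewrite dec-false (P? v) (≤⇒≯ p≤v) = ≡.refl

    P<P : ∀ {v u} → P v → P u → toℕ v < toℕ u → height v < height u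
    P<P {v} {u} pv pu v<u rewrite height-P pv | height-P pu =
      *-monoˡ-< (p + q) {{>-nonZero (≤-trans 0<p (m≤m+n p q))}} (s≤s v<u)

    Q<Q : ∀ {v u} → p ≤ toℕ v → p ≤ toℕ u → toℕ v < toℕ u → height v < height u
    Q<Q {v} {u} pv pu v<u rewrite height-Q pv | height-Q pu =
      +-mono-≤-< (*-monoˡ-≤ (p + q) (+-monoʳ-≤ f (bump-mono (<⇒≤ v<u)))) v<u

    P<Q : ∀ {v u} → P v → p ≤ toℕ u → toℕ v < depth (toℕ u) → height v < height u
    P<Q {v} {u} pv pu v<d rewrite height-P pv | height-Q pu =
      -- The multiples of p + q may coincide; the index of `u`, positive since it is at least `p`,
      -- breaks the tie.
      ≤-<-trans (*-monoˡ-≤ (p + q) v<d) (m<m+n _ (≤-trans 0<p pu))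

    Q<P : ∀ {v u} → p ≤ toℕ v → P u → depth (toℕ v) ≤ toℕ u → height v < height u
    Q<P {v} {u} pv pu d≤u rewrite height-Q pv | height-P pu = <-≤-trans
      (+-monoʳ-< (depth (toℕ v) * (p + q)) (toℕ<n v))
      (≤-trans (≤-reflexive (+-comm _ (p + q))) (*-monoˡ-≤ (p + q) (s≤s d≤u)))

    precedes : Fin (p + q) → Fin (p + q) → ℕ
    precedes v u = below (height v) (height u)

    open LowerBound P? _≟_ precedes (λ v u → below≤1 (height v) (height u))

    -- Flipped, because heights are counted from below while words are read from the root.
    order : DecTotalOrder 0ℓ 0ℓ 0ℓ
    order = Flip.decTotalOrder (On.decTotalOrder ≤-decTotalOrder height)

    target : List (Fin (p + q))
    target = Sort.sort order base

    target-↭ : target ↭ base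
    target-↭ = Sort.sort-↭ order base

    target-sorted : AllPairs (λ v u → precedes u v ≡ 0) target
    target-sorted = AllPairs.map below-≥
      (SortedP.Sorted⇒AllPairs (DecTotalOrder.totalOrder order) (Sort.sort-↗ order base))

    module Cost (S : Fin (p + q) → Bool) (avoids : Avoids S) where

      inS outS bumps : Fin (p + q) → ℕ
      inS v   = if S v then 1 else 0
      outS v  = if S v then 0 else 1
      bumps v = if S v then 0 else bump (toℕ v)
      both : Fin (p + q) → Fin (p + q) → ℕ
      both v u = if S v then (if S u then 1 else 0) else 0
      -- Twice the depth of a vertex outside `S`, and 0 on `S`. A vertex of `S` descends past all of
      -- P and climbs back over as many as its depth, p + depth swaps; outside `S` only p - depth
      -- are forced. The slack makes up the difference without subtraction.
      slack : Fin (p + q) → ℕ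
      slack v = 2 * (f * outS v + bumps v)

      s t l : ℕ
      s = sumBy inS qs
      t = sumBy outS qs
      l = sumBy bumps qs

      s+t≡q : s + t ≡ q
      s+t≡q = begin
        s + t                          ≡⟨ sumBy-+ inS outS qs ⟨
        sumBy (λ v → inS v + outS v) qs ≡⟨ sumBy≡const (All.universal one qs) ⟩
        length qs * 1                  ≡⟨ *-identityʳ _ ⟩
        length qs                      ≡⟨ length-qs ⟩
        q                              ∎
        where
        open ≡.≡-Reasoning
        one : ∀ v → inS v + outS v ≡ 1
        one v with S v
        ... | true  = ≡.refl
        ... | false = ≡.refl

      l≤t : l ≤ t
      l≤t = sumBy-mono (All.universal le qs)
        where
        le : ∀ v → bumps v ≤ outS v
        le v with S v
        ... | true  = z≤n
        ... | false = bump≤1 (toℕ v)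

      l≤r : l ≤ r
      l≤r = ≤-trans (sumBy-mono (All.universal le qs)) (≤-reflexive sumBy-bump)
        where
        le : ∀ v → bumps v ≤ bump (toℕ v)
        le v with S v
        ... | true  = z≤n
        ... | false = ≤-refl

      sumBy-slack : sumBy slack qs ≡ 2 * (f * t + l)
      sumBy-slack = begin
        sumBy slack qs
          ≡⟨ sumBy-* 2 (λ v → f * outS v + bumps v) qs ⟩
        2 * sumBy (λ v → f * outS v + bumps v) qs
          ≡⟨ cong (2 *_) (sumBy-+ (λ v → f * outS v) bumps qs) ⟩
        2 * (sumBy (λ v → f * outS v) qs + l)
          ≡⟨ cong (λ m → 2 * (m + l)) (sumBy-* f outS qs) ⟩
        2 * (f * t + l) ∎
        where open ≡.≡-Reasoning

      -- Vertices left out of `S` save their slack, but every pair of Q that meets them must then be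
      -- swapped. The saving never exceeds the price.
      few-pairs : s C 2 + sumBy slack qs ≤ q C 2
      few-pairs = begin
        s C 2 + sumBy slack qs     ≡⟨ cong (s C 2 +_) sumBy-slack ⟩
        s C 2 + 2 * (f * t + l)    ≤⟨ light {s} {t} {l} {f} {g} q≡
                                        (heavy {s} {t} {l} {f} {g} {r} q≡ l≤t l≤r 4r≤) ⟩
        (s + t) C 2                ≡⟨ cong (_C 2) s+t≡q ⟩
        q C 2                      ∎
        where
        open ≤-Reasoning
        open +-*-Solver
        balanced′ : (1 + 4 * f) * q + 4 * r ≤ q * q
        balanced′ = ≤-trans (≤-reflexive (solve 3 (λ f q r →
          (con 1 :+ con 4 :* f) :* q :+ con 4 :* r := con 4 :* (f :* q :+ r) :+ q) ≡.refl
            f q r)) balanced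
        1+4f≤q : 1 + 4 * f ≤ q
        1+4f≤q = *-cancelʳ-≤ _ _ q {{>-nonZero 0<q}} (begin
          (1 + 4 * f) * q         ≤⟨ m≤m+n _ (4 * r) ⟩
          (1 + 4 * f) * q + 4 * r ≤⟨ balanced′ ⟩
          q * q                   ∎)
        g : ℕ
        -- The room that `balanced` leaves when all depths equal `f`; the extra depth `r` has to fit
        -- into it, as 4r ≤ gq.
        g = q ∸ (1 + 4 * f)
        q≡ : s + t ≡ 1 + 4 * f + g
        q≡ = ≡.trans s+t≡q (≡.sym (m+[n∸m]≡n 1+4f≤q))
        4r≤ : 4 * r ≤ g * (s + t)
        4r≤ = +-cancelˡ-≤ ((1 + 4 * f) * q) _ _ (begin
          (1 + 4 * f) * q + 4 * r       ≤⟨ balanced′ ⟩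
          q * q                         ≡⟨ cong (_* q) (m+[n∸m]≡n 1+4f≤q) ⟨
          (1 + 4 * f + g) * q           ≡⟨ *-distribʳ-+ q (1 + 4 * f) g ⟩
          (1 + 4 * f) * q + g * q       ≡⟨ cong (λ m → (1 + 4 * f) * q + g * m) s+t≡q ⟨
          (1 + 4 * f) * q + g * (s + t) ∎)

      on-ps : p C 2 ≤ pairSum (charge S) ps
      on-ps = begin
        p C 2                     ≡⟨ cong (_C 2) length-ps ⟨
        length ps C 2             ≡⟨ *-identityʳ _ ⟨
        (length ps C 2) * 1       ≡⟨ pairSum-const 1 ps ⟨
        pairSum (λ _ _ → 1) ps    ≤⟨ pairSum-mono (one all-ps increasing-ps) ⟩
        pairSum (charge S) ps     ∎
        where
        open ≤-Reasoning
        one : ∀ {w} → All P w → AllPairs (λ v u → toℕ v < toℕ u) w →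
          AllPairs (λ v u → 1 ≤ charge S v u) w
        one []         []         = []
        one (pv ∷ pvs) (v< ∷ inc) = All.zipWith (λ (pu , v<u) → ≤-reflexive
          (≡.sym (≡.trans (charge-f S (avoids pv)) (below-< (P<P pv pu v<u))))) (pvs , v<)
          ∷ one pvs inc

      -- Every pair of Q is inverted in the target, and only those inside `S` can be inverted for
      -- free.
      on-qs : q C 2 ≤ pairSum (charge S) qs + s C 2
      on-qs = begin
        q C 2                     ≡⟨ cong (_C 2) length-qs ⟨
        length qs C 2             ≡⟨ *-identityʳ _ ⟨
        (length qs C 2) * 1       ≡⟨ pairSum-const 1 qs ⟨
        pairSum (λ _ _ → 1) qs    ≤⟨ pairSum-mono (one all-qs increasing-qs) ⟩
        pairSum (λ v u → charge S v u + both v u) qs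
                                  ≡⟨ pairSum-+ (charge S) both qs ⟩
        pairSum (charge S) qs + pairSum both qs
                                  ≡⟨ cong (pairSum (charge S) qs +_) (pairSum-indicator S qs) ⟩
        pairSum (charge S) qs + s C 2 ∎
        where
        open ≤-Reasoning
        pair : ∀ {v u} → height v < height u → 1 ≤ charge S v u + both v u
        pair {v} {u} v<u with S v | S u
        ... | true  | true  = ≤-refl
        ... | true  | false = s≤s z≤n
        ... | false | _     = ≤-trans (≤-reflexive (≡.sym (below-< v<u))) (m≤m+n _ _)
        one : ∀ {w} → All (λ v → p ≤ toℕ v) w → AllPairs (λ v u → toℕ v < toℕ u) w →
          AllPairs (λ v u → 1 ≤ charge S v u + both v u) w
        one []         []         = []
        one (pv ∷ pvs) (v< ∷ inc) =
          All.zipWith (λ (pu , v<u) → pair (Q<Q pv pu v<u)) (pvs , v<) ∷ one pvs inc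

      -- The d vertices of P of smallest index end up below `x`. In `S`, they cost 2 and the others
      -- 1; outside `S`, only the others are charged.
      across-one : ∀ {x} → p ≤ toℕ x → p + depth (toℕ x) ≤ sumBy (charge S x) ps + slack x
      across-one {x} p≤x = go (S x) ≡.refl
        where
        open ≤-Reasoning
        open +-*-Solver
        d : ℕ
        d = depth (toℕ x)
        count : sumBy (λ v → below d (toℕ v)) ps ≡ d
        count = count-ps (depth≤p x)
        ones : sumBy (λ _ → 1) ps ≡ p
        ones = ≡.trans (sumBy-const 1 ps) (≡.trans (*-identityʳ _) length-ps)
        up : ∀ {v} → P v → suc (below d (toℕ v)) ≤ suc (precedes x v)
        up {v} pv with toℕ v <? d
        ... | yes v<d = s≤s (≤-trans (below≤1 d (toℕ v))
          (≤-reflexive (≡.sym (below-< (P<Q pv p≤x v<d)))))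
        ... | no v≮d  = s≤s (≤-trans (≤-reflexive (below-≥ (≮⇒≥ v≮d))) z≤n)
        down : ∀ {v} → P v → 1 ≤ precedes v x + below d (toℕ v)
        down {v} pv with toℕ v <? d
        ... | yes v<d = ≤-trans (≤-reflexive (≡.sym (below-< v<d))) (m≤n+m _ (precedes v x))
        ... | no v≮d  =
          ≤-trans (≤-reflexive (≡.sym (below-< (Q<P p≤x pv (≮⇒≥ v≮d))))) (m≤m+n _ _)
        slack-f : S x ≡ false → slack x ≡ 2 * (f * 1 + bump (toℕ x))
        slack-f eq rewrite eq = ≡.refl
        go : ∀ b → S x ≡ b → p + d ≤ sumBy (charge S x) ps + slack x
        go true eq = begin
          p + d
            ≡⟨ cong₂ _+_ ones count ⟨
          sumBy (λ _ → 1) ps + sumBy (λ v → below d (toℕ v)) ps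
            ≡⟨ sumBy-+ (λ _ → 1) (λ v → below d (toℕ v)) ps ⟨
          sumBy (λ v → suc (below d (toℕ v))) ps
            ≤⟨ sumBy-mono (All.map (λ pv → ≤-trans (up pv)
                 (≤-reflexive (≡.sym (charge-tf S eq (avoids pv))))) all-ps) ⟩
          sumBy (charge S x) ps
            ≤⟨ m≤m+n _ (slack x) ⟩
          sumBy (charge S x) ps + slack x ∎
        go false eq = begin
          p + d
            ≡⟨ cong (_+ d) ones ⟨
          sumBy (λ _ → 1) ps + d
            ≤⟨ +-monoˡ-≤ d (sumBy-mono (All.map (λ pv → ≤-trans (down pv)
                 (≤-reflexive (cong (_+ below d _) (≡.sym (charge-f S eq))))) all-ps)) ⟩
          sumBy (λ v → charge S x v + below d (toℕ v)) ps + d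
            ≡⟨ cong (_+ d) (≡.trans (sumBy-+ (charge S x) (λ v → below d (toℕ v)) ps)
                 (cong (sumBy (charge S x) ps +_) count)) ⟩
          sumBy (charge S x) ps + d + d
            ≡⟨ solve 3 (λ m f b → m :+ (f :+ b) :+ (f :+ b)
                 := m :+ con 2 :* (f :* con 1 :+ b)) ≡.refl
                 (sumBy (charge S x) ps) f (bump (toℕ x)) ⟩
          sumBy (charge S x) ps + 2 * (f * 1 + bump (toℕ x))
            ≡⟨ cong (sumBy (charge S x) ps +_) (slack-f eq) ⟨
          sumBy (charge S x) ps + slack x ∎

      across : q * p + (f * q + r) ≤ sumBy (λ x → sumBy (charge S x) ps) qs + sumBy slack qs
      across = begin
        q * p + (f * q + r)
          ≡⟨ cong₂ (λ a b → a * p + (f * b + r)) length-qs length-qs ⟨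
        length qs * p + (f * length qs + r)
          ≡⟨ cong₂ (λ a b → length qs * p + (a + b)) (*-comm f (length qs)) (≡.sym sumBy-bump) ⟩
        length qs * p + (length qs * f + sumBy (λ v → bump (toℕ v)) qs)
          ≡⟨ cong₂ (λ a b → a + (b + sumBy (λ v → bump (toℕ v)) qs))
               (sumBy-const p qs) (sumBy-const f qs) ⟨
        sumBy (λ _ → p) qs + (sumBy (λ _ → f) qs + sumBy (λ v → bump (toℕ v)) qs)
          ≡⟨ cong (sumBy (λ _ → p) qs +_) (sumBy-+ (λ _ → f) (λ v → bump (toℕ v)) qs) ⟨
        sumBy (λ _ → p) qs + sumBy (λ v → depth (toℕ v)) qs
          ≡⟨ sumBy-+ (λ _ → p) (λ v → depth (toℕ v)) qs ⟨
        sumBy (λ v → p + depth (toℕ v)) qs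
          ≤⟨ sumBy-mono (All.map across-one all-qs) ⟩
        sumBy (λ x → sumBy (charge S x) ps + slack x) qs
          ≡⟨ sumBy-+ (λ x → sumBy (charge S x) ps) slack qs ⟩
        sumBy (λ x → sumBy (charge S x) ps) qs + sumBy slack qs ∎
        where open ≤-Reasoning

      cost : p * q + (f * q + r) + p C 2 ≤ pairSum (charge S) base
      cost = +-cancelʳ-≤ (s C 2 + sumBy slack qs) _ _ (begin
        p * q + (f * q + r) + p C 2 + (s C 2 + sumBy slack qs)
          ≤⟨ +-monoʳ-≤ (p * q + (f * q + r) + p C 2) few-pairs ⟩
        p * q + (f * q + r) + p C 2 + q C 2
          ≡⟨ cong (λ m → m + (f * q + r) + p C 2 + q C 2) (*-comm p q) ⟩
        q * p + (f * q + r) + p C 2 + q C 2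
          ≤⟨ +-mono-≤ (+-mono-≤ across on-ps) on-qs ⟩
        sumBy (λ x → sumBy (charge S x) ps) qs + sumBy slack qs + pairSum (charge S) ps
          + (pairSum (charge S) qs + s C 2)
          ≡⟨ solve 5 (λ a b c d e → a :+ b :+ c :+ (d :+ e) := d :+ a :+ c :+ (e :+ b)) ≡.refl
               (sumBy (λ x → sumBy (charge S x) ps) qs) (sumBy slack qs) (pairSum (charge S) ps)
               (pairSum (charge S) qs) (s C 2) ⟩
        pairSum (charge S) qs + sumBy (λ x → sumBy (charge S x) ps) qs + pairSum (charge S) ps
          + (s C 2 + sumBy slack qs)
          ≡⟨ cong (_+ (s C 2 + sumBy slack qs)) (pairSum-++ (charge S) qs ps) ⟨
        pairSum (charge S) base + (s C 2 + sumBy slack qs) ∎)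
        where
        open ≤-Reasoning
        open +-*-Solver

    lower : ∃ λ T → ∃ λ U → SearchTree (SPK p q) T × SearchTree (SPK p q) U ×
      (∀ k → Walk (SPK p q) k T U → p * q + (f * q + r) + p C 2 ≤ k)
    lower =
      let target-word = word-↭ (↭-sym target-↭) base-word
          T , tT = represent base-word
          U , uU = represent target-word
      in T , U , represented-search base-word tT , represented-search target-word uU ,
         λ k walk →
           let S , avoids , _ , bound = path-bound
                 (walk⇒path walk base-word target-word tT uU) (Word.unique base-word) target-sorted
           in ≤-trans (Cost.cost S avoids) bound

-- Choice of the depths in the two ranges of q

theorem8 : (p q : ℕ) → 1 ≤ p → 1 ≤ q →
    (4 * p + 1 ≤ q →
    Diameter (SPK p q) (2 * p * q + p C 2)
    × 2 * p * q + p C 2 ≡ 2 * edgesSPK p q ∸ p C 2)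
    × (q < 4 * p + 1 →
    Diameter (SPK p q) (p * q + (q C 2) / 2 + p C 2)
    × p * q + (q C 2) / 2 + p C 2 ≤ 2 * edgesSPK p q)
theorem8 p q 0<p 0<q = many , few
  where
  open SplitGraph p q 0<p
  open ≤-Reasoning
  open +-*-Solver

  2edges : 2 * edgesSPK p q ≡ 2 * p * q + p C 2 + p C 2
  2edges = solve 3 (λ p q c → con 2 :* (p :* q :+ c) := con 2 :* p :* q :+ c :+ c) ≡.refl p q (p C 2)

  many : 4 * p + 1 ≤ q → Diameter (SPK p q) (2 * p * q + p C 2)
    × 2 * p * q + p C 2 ≡ 2 * edgesSPK p q ∸ p C 2
  many 4p<q = (upper sinking , subst (λ d → ∃ λ T → ∃ λ U → SearchTree (SPK p q) T ×
      SearchTree (SPK p q) U × (∀ k → Walk (SPK p q) k T U → d ≤ k)) depth-sum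
      -- Every depth is the largest possible, `p`: in the target Q is again above all of P.
      (Extremal.lower 0<q p 0 ≤-refl z≤n (λ ()) balanced)) ,
    ≡.sym (≡.trans (cong (_∸ p C 2) 2edges) (m+n∸n≡m (2 * p * q + p C 2) (p C 2)))
    where
    sinking : ∀ {k l a b} → a ≤ p * q → b ≤ p * q → k + (a + b) ≤ (p + q) C 2 + p * q →
      l ≤ a + b + p C 2 → k ≤ 2 * p * q + p C 2 ⊎ l ≤ 2 * p * q + p C 2
    sinking {k} {l} {a} {b} a≤ b≤ _ l≤ = inj₂ (begin
      l                             ≤⟨ l≤ ⟩
      a + b + p C 2                 ≤⟨ +-monoˡ-≤ (p C 2) (+-mono-≤ a≤ b≤) ⟩
      p * q + p * q + p C 2         ≡⟨ solve 3 (λ p q c → p :* q :+ p :* q :+ c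
                                         := con 2 :* p :* q :+ c) ≡.refl p q (p C 2) ⟩
      2 * p * q + p C 2             ∎)
    depth-sum : p * q + (p * q + 0) + p C 2 ≡ 2 * p * q + p C 2
    depth-sum = solve 3 (λ p q c → p :* q :+ (p :* q :+ con 0) :+ c
      := con 2 :* p :* q :+ c) ≡.refl p q (p C 2)
    balanced : 4 * (p * q + 0) + q ≤ q * q
    balanced = begin
      4 * (p * q + 0) + q ≡⟨ solve 2 (λ p q → con 4 :* (p :* q :+ con 0) :+ q
                               := (con 4 :* p :+ con 1) :* q) ≡.refl p q ⟩
      (4 * p + 1) * q     ≤⟨ *-monoˡ-≤ q 4p<q ⟩
      q * q               ∎

  few : q < 4 * p + 1 → Diameter (SPK p q) (p * q + (q C 2) / 2 + p C 2)
    × p * q + (q C 2) / 2 + p C 2 ≤ 2 * edgesSPK p q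
  few q≤4p = (upper choose , subst (λ d → ∃ λ T → ∃ λ U → SearchTree (SPK p q) T ×
      SearchTree (SPK p q) U × (∀ k → Walk (SPK p q) k T U → d ≤ k))
      (cong (λ m → p * q + m + p C 2) (≡.sym E≡))
      (Extremal.lower 0<q f r f≤p (<⇒≤ r<q) f<p balanced)) ,
    (begin
      p * q + E + p C 2             ≤⟨ +-monoˡ-≤ (p C 2) (+-monoʳ-≤ (p * q) E≤pq) ⟩
      p * q + p * q + p C 2         ≤⟨ m≤m+n _ (p C 2) ⟩
      p * q + p * q + p C 2 + p C 2 ≡⟨ solve 3 (λ p q c → p :* q :+ p :* q :+ c :+ c
                                         := con 2 :* (p :* q :+ c)) ≡.refl p q (p C 2) ⟩
      2 * edgesSPK p q              ∎)
    where
    instance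
      q≢0 : NonZero q
      q≢0 = >-nonZero 0<q

    -- The total depth `E` is distributed over Q as evenly as possible by division with remainder.
    E f r : ℕ
    E = (q C 2) / 2
    f = E / q
    r = E % q

    r<q : r < q
    r<q = m%n<n E q

    E≡ : E ≡ f * q + r
    E≡ = ≡.trans (m≡m%n+[m/n]*n E q) (+-comm r (f * q))

    4E+q≤q² : 4 * E + q ≤ q * q
    4E+q≤q² = begin
      4 * E + q         ≡⟨ cong (_+ q)
                             (solve 1 (λ e → con 4 :* e := con 2 :* (e :* con 2)) ≡.refl E) ⟩
      2 * (E * 2) + q   ≤⟨ +-monoˡ-≤ q (*-monoʳ-≤ 2 (m/n*n≤m (q C 2) 2)) ⟩
      2 * (q C 2) + q   ≡⟨ C2-double q ⟩
      q * q             ∎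

    balanced : 4 * (f * q + r) + q ≤ q * q
    balanced = subst (λ m → 4 * m + q ≤ q * q) E≡ 4E+q≤q²

    -- Here q ≤ 4p + 1 enters: the total depth `E` fits under q vertices of depth at most `p`. The
    -- comparison with 2m follows as well.
    E≤pq : E ≤ p * q
    E≤pq = *-cancelˡ-≤ 4 (+-cancelʳ-≤ q _ _ (begin
      4 * E + q           ≤⟨ 4E+q≤q² ⟩
      q * q               ≤⟨ *-monoˡ-≤ q (<⇒≤ q≤4p) ⟩
      (4 * p + 1) * q     ≡⟨ solve 2 (λ p q → (con 4 :* p :+ con 1) :* q
                               := con 4 :* (p :* q) :+ q) ≡.refl p q ⟩
      4 * (p * q) + q     ∎))

    f≤p : f ≤ p
    f≤p = *-cancelʳ-≤ f p q (≤-trans (m/n*n≤m E q) E≤pq)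

    f<p : 0 < r → f < p
    f<p 0<r = *-cancelʳ-< q f p (begin-strict
      f * q       <⟨ m<m+n (f * q) 0<r ⟩
      f * q + r   ≡⟨ E≡ ⟨
      E           ≤⟨ E≤pq ⟩
      p * q       ∎)

    -- The sinking costs a + b, a gain for one strategy and a loss for the other, cancel in k + l.
    choose : ∀ {k l a b} → a ≤ p * q → b ≤ p * q → k + (a + b) ≤ (p + q) C 2 + p * q →
      l ≤ a + b + p C 2 → k ≤ p * q + E + p C 2 ⊎ l ≤ p * q + E + p C 2
    choose {k} {l} {a} {b} _ _ k≤ l≤ =
      subst (λ d → k ≤ d ⊎ l ≤ d)
        (solve 3 (λ m c e → m :+ c :+ e := m :+ e :+ c) ≡.refl (p * q) (p C 2) E)
        (average {d = p * q + p C 2} {x = q C 2} (begin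
          k + l                       ≤⟨ +-monoʳ-≤ k l≤ ⟩
          k + (a + b + p C 2)         ≡⟨ +-assoc k (a + b) (p C 2) ⟨
          k + (a + b) + p C 2         ≤⟨ +-monoˡ-≤ (p C 2) k≤ ⟩
          (p + q) C 2 + p * q + p C 2 ≡⟨ cong (λ m → m + p * q + p C 2) (C2-+ p q) ⟩
          p C 2 + q C 2 + p * q + p * q + p C 2
            ≡⟨ solve 3 (λ m c e → c :+ e :+ m :+ m :+ c := con 2 :* (m :+ c) :+ e) ≡.refl
                 (p * q) (p C 2) (q C 2) ⟩
          2 * (p * q + p C 2) + q C 2 ∎))
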